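{- Any standard resizable array data structure that uses only $N+O(rN^{1/r})$ space to store an array of size $N$, where $r=O(\log N)$, must have an amortized cost of $\Omega(r)$ for grow operations.
   Context: A resizable array stores a sequence $a_0,\dots,a_{N-1}$ ($N$ is its current size) and supports: creating an empty array, returning its length, reading or overwriting the $i$-th item, Grow$(a)$ which appends a new last item, and Shrink() which removes the last item. An implementation keeps its data in dynamically allocated fixed-length contiguous blocks of memory words; each item occupies one word and each pointer one word; every block other than a single main index block must be pointed to from some block. The space used at any moment is the total length of all currently allocated blocks. For non-decreasing functions $s,t$, an $(s(N),t(N))$-implementation uses at most $N+s(N)$ space to store an array of size $N$, and at most $N+t(N)$ space at any moment during a grow or shrink operation. Such an implementation is standard if: (i) whenever a new block $B$ is allocated, items from some other blocks $A_1,\dots,A_k$ are immediately copied into it in sequential order — all items of $A_1$ into the first positions of $B$, then $A_1$ is released, then the items of $A_2$ into the next positions, then $A_2$ is released, and so on; and (ii) following each such operation the total space used is $N+s(N)$ (within the storage bound). The cost of an operation counts item assignments (copying or writing an item into a block). -}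

module Defs where

open import Data.Nat using (ℕ; zero; suc; _+_; _*_; _^_; _≤_; _<_)
open import Data.Fin using (Fin)
open import Data.Nat.ListAction using (sum)
open import Data.List using (List; []; _∷_; length; map; concatMap; replicate; _++_; _[_]∷=_)
open import Data.List.Membership.Propositional using (_∈_; _∉_)
open import Data.List.Relation.Binary.Permutation.Propositional using (_↭_)
open import Data.List.Relation.Unary.All using (All)
open import Data.List.Relation.Unary.Any using (Any)
open import Data.Product using (Σ; ∃; _×_)
open import Relation.Binary.PropositionalEquality using (_≡_)

-- Memory model
--
-- Memory consists of blocks.  Every block has an identifier (used by
-- pointers) and a fixed-length list of words.  A word holds an array item
-- (identified by its position i: the word stores the value a_i), a pointer
-- to the block with a given identifier, or nothing.

data Word : Set where
  item  : ℕ → Word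
  ptr   : ℕ → Word
  empty : Word

record Block : Set where
  constructor block
  field
    bid   : ℕ
    words : List Word
open Block public

Memory : Set
Memory = List Block

blockLen : Block → ℕ
blockLen b = length (words b)

space : Memory → ℕ
space m = sum (map blockLen m)

wordCost : Word → ℕ
wordCost (item _) = 1
wordCost (ptr _)  = 0
wordCost empty    = 0

itemCount : List Block → ℕ
itemCount bs = sum (map wordCost (concatMap words bs))

bids : Memory → List ℕ
bids m = map bid m

-- Elementary steps performed while the array grows to size  n.
--   * `bound` is the storage bound  n + s(n)  that must hold after each
--     allocation (condition (ii) of a standard implementation).
--   * Only items a_0 .. a_{n-1} exist, so only those can be written.

data Step (n bound : ℕ) : Memory → Memory → ℕ → Set where
  write : ∀ {m rest} (b : Block) (k : Fin (length (words b))) (w : Word) →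
          (∀ i → w ≡ item i → i < n) →
          m ↭ (b ∷ rest) →
          Step n bound m (block (bid b) (words b [ k ]∷= w) ∷ rest) (wordCost w)
  alloc : ∀ {m rest} (srcs : List Block) (newId e : ℕ) →
          m ↭ (srcs ++ rest) →
          newId ∉ bids m →
          space (block newId (concatMap words srcs ++ replicate e empty) ∷ rest) ≤ bound →
          Step n bound m (block newId (concatMap words srcs ++ replicate e empty) ∷ rest)
               (itemCount srcs)
  release : ∀ {m rest} (b : Block) → m ↭ (b ∷ rest) → Step n bound m rest 0

data Steps (n bound : ℕ) : Memory → Memory → ℕ → Set where
  done : ∀ {m} → Steps n bound m m 0
  _∷ˢ_ : ∀ {m m′ m″ c c′} → Step n bound m m′ c → Steps n bound m′ m″ c′ →
         Steps n bound m m″ (c + c′)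

Stored : ℕ → Memory → Set
Stored i m = Any (λ b → item i ∈ words b) m

PointedTo : Memory → Block → Set
PointedTo m b = Any (λ b′ → ptr (bid b) ∈ words b′) m

PointerInvariant : Memory → Set
PointerInvariant m = Σ Block λ main → main ∈ m ×
  All (λ b → b ≡ main ⊎′ PointedTo m b) m
  where
  open import Data.Sum using () renaming (_⊎_ to _⊎′_)

Represents : (s : ℕ → ℕ) → ℕ → Memory → Set
Represents s n m =
  (∀ i → i < n → Stored i m) × PointerInvariant m × space m ≤ n + s n

-- An execution of a standard (s, ·)-implementation performing n Grow
-- operations starting from an empty array, ending in memory m, at total
-- cost c.  (The bound t during operations is irrelevant for a finite
-- execution and is therefore not recorded.)
data GrowExec (s : ℕ → ℕ) : ℕ → Memory → ℕ → Set where
  start : ∀ {m} → Represents s 0 m → GrowExec s 0 m 0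
  grow  : ∀ {n m m′ c c′} → GrowExec s n m c →
          Steps (suc n) (suc n + s (suc n)) m m′ c′ →
          Represents s (suc n) m′ →
          GrowExec s (suc n) m′ (c + c′)

NonDecreasing : (ℕ → ℕ) → Set
NonDecreasing f = ∀ {a b} → a ≤ b → f a ≤ f b

{-# OPTIONS --safe #-}
-- Over one grow operation, the total block length weighted by any function f of
-- the block lengths rises by at most its value on the blocks that are born and
-- survive it, and these blocks are paid for up to s(N) free words.  Fix lengths
-- T₀ < T₁ < ... < T_J with ratio b ≈ C N^{1/r}, where J = Ω(r).  Between times
-- t − T_{j+1} and t the array gains T_{j+1} items, which must sit in surviving
-- blocks shorter than T_j or in newborn blocks of length at least T_j.  There are
-- only O(r N^{1/r}) blocks at time t, so for most j the short ones cannot hold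
-- them.  A newborn block of length L counts for level j with weight
-- min(L, T_{j+1}); these weights form a geometric series in j, so all levels
-- together charge it O(L), while every level needs Ω(N) in total.
module Submission where

open import Defs
open import Data.Bool using (Bool; true; false)
open import Data.Empty using (⊥-elim)
open import Data.Fin using (Fin; zero; suc)
open import Data.List using (List; []; _∷_; _++_; map; concatMap; mapMaybe; length; replicate; upTo; _[_]∷=_)
open import Data.List.Membership.Propositional using (_∈_; _∉_)
open import Data.List.Membership.Propositional.Properties
  using (∈-∃++; ∈-++⁺ʳ; ∈-map⁺; ∈-map⁻; ∈-concatMap⁺; ∈-upTo⁻)
open import Data.List.Properties
  using (map-++; map-cong; length-upTo; map-∘; map-id; ∷-injectiveˡ; ∷-injectiveʳ; length-∷=; mapMaybe-++; ++-assoc)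
open import Data.List.Relation.Binary.Permutation.Propositional using (_↭_; ↭⇒↭ₛ; ↭-sym)
import Data.List.Relation.Binary.Permutation.Propositional.Properties as Perm
open import Data.List.Relation.Binary.Permutation.Setoid.Properties using (Unique-resp-↭)
open import Data.List.Relation.Unary.All as All using (All; []; _∷_)
open import Data.List.Relation.Unary.Any using (here; there)
open import Data.List.Relation.Unary.Unique.Propositional using (Unique; []; _∷_)
import Data.List.Relation.Unary.Unique.Propositional.Properties as Unique
open import Data.Maybe using (Maybe; just; nothing)
open import Data.Nat
open import Data.Nat.DivMod using (m≡m%n+[m/n]*n; m%n<n; m/n*n≤m; m≥n⇒m/n>0; /-monoˡ-≤; m*n/n≡m)
open import Data.Nat.ListAction using (sum)
open import Data.Nat.ListAction.Properties using (sum-++; sum-↭)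
open import Data.Nat.Logarithm using (⌊log₂_⌋; ⌊log₂⌋-mono-≤; ⌊log₂⌊n/2⌋⌋≡⌊log₂n⌋∸1; ⌊log₂[2^n]⌋≡n)
open import Data.Nat.Properties
open import Data.Nat.Tactic.RingSolver using (solve-∀)
open import Data.Product using (Σ; ∃; ∃₂; _×_; _,_; proj₁; proj₂; map₁; map₂)
open import Data.Sum using (_⊎_; inj₁; inj₂)
open import Function using (_∘_; id)
open import Relation.Binary.PropositionalEquality
  using (_≡_; refl; sym; trans; cong; cong₂; subst; setoid; module ≡-Reasoning)
open import Relation.Nullary using (yes; no; contradiction)

-- The `S` free words of each grow operation must not be added up: over `N` operations they could
-- exceed the claimed cost. Hence the lowest length is some `W ≥ 2 * S`. If a grow operation leaves
-- newborn blocks of length at least `W`, their total length is at least twice the slack and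
-- therefore at most twice the cost. The cap `T_{j+1}` is the whole demand of one window; without it
-- a block of length `L` would be charged `L` by every level below it. No single level is selected.
-- Every level is averaged over the same `M` end times, and level `j` is multiplied by
-- `b ^ (J ∸ suc j)`, which turns `T_{j+1}` into `T_J`. On this common scale the short blocks
-- present at one time are charged for all levels at once: a second geometric series bounds the
-- share of each nonempty block by `2 * T_J / b`.

private variable
  A B : Set

-- Weighted sums over lists

total : (A → ℕ) → List A → ℕ
total f xs = sum (map f xs)

total-++ : (f : A → ℕ) (xs ys : List A) → total f (xs ++ ys) ≡ total f xs + total f ys
total-++ f xs ys = trans (cong sum (map-++ f xs ys)) (sum-++ (map f xs) (map f ys))

total-↭ : (f : A → ℕ) {xs ys : List A} → xs ↭ ys → total f xs ≡ total f ys
total-↭ f p = sum-↭ (Perm.map⁺ f p)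

total-map : (f : B → ℕ) (g : A → B) (xs : List A) → total f (map g xs) ≡ total (f ∘ g) xs
total-map f g xs = cong sum (sym (map-∘ xs))

total-concatMap : (f : B → ℕ) (g : A → List B) (xs : List A) →
                  total f (concatMap g xs) ≡ total (total f ∘ g) xs
total-concatMap f g []       = refl
total-concatMap f g (x ∷ xs) =
  trans (total-++ f (g x) (concatMap g xs)) (cong (total f (g x) +_) (total-concatMap f g xs))

total-mono : {f g : A → ℕ} → (∀ x → f x ≤ g x) → (xs : List A) → total f xs ≤ total g xs
total-mono f≤g []       = z≤n
total-mono f≤g (x ∷ xs) = +-mono-≤ (f≤g x) (total-mono f≤g xs)

+-interchange : ∀ a b c d → a + b + (c + d) ≡ a + c + (b + d)
+-interchange = solve-∀

total-+ : (f g : A → ℕ) (xs : List A) → total (λ x → f x + g x) xs ≡ total f xs + total g xs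
total-+ f g []       = refl
total-+ f g (x ∷ xs) = trans (cong (f x + g x +_) (total-+ f g xs)) (+-interchange (f x) (g x) (total f xs) (total g xs))

total-* : (k : ℕ) (f : A → ℕ) (xs : List A) → total (λ x → k * f x) xs ≡ k * total f xs
total-* k f []       = sym (*-zeroʳ k)
total-* k f (x ∷ xs) = trans (cong (k * f x +_) (total-* k f xs)) (sym (*-distribˡ-+ k (f x) _))

total-const : (k : ℕ) (xs : List A) → total (λ _ → k) xs ≡ length xs * k
total-const k []       = refl
total-const k (x ∷ xs) = cong (k +_) (total-const k xs)

-- A weighted pigeonhole principle. Uniqueness of `xs` allows the occurrence matched with `x` to be
-- deleted from `ys` before the tail is matched; `ys` may contain repetitions.
total-⊆ : (f : A → ℕ) {xs ys : List A} → Unique xs → (∀ {x} → x ∈ xs → x ∈ ys) → total f xs ≤ total f ys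
total-⊆ f {[]}     []           _     = z≤n
total-⊆ f {x ∷ xs} (x≢xs ∷ uxs) xs⊆ys with ∈-∃++ (xs⊆ys (here refl))
... | ys₁ , ys₂ , refl = begin
  f x + total f xs               ≤⟨ +-monoʳ-≤ (f x) (total-⊆ f uxs xs⊆ys₁₂) ⟩
  f x + total f (ys₁ ++ ys₂)     ≡⟨ total-↭ f (Perm.shift x ys₁ ys₂) ⟨
  total f (ys₁ ++ x ∷ ys₂)       ∎
  where
  open ≤-Reasoning
  xs⊆ys₁₂ : ∀ {z} → z ∈ xs → z ∈ ys₁ ++ ys₂
  xs⊆ys₁₂ z∈xs with Perm.∈-resp-↭ (Perm.shift x ys₁ ys₂) (xs⊆ys (there z∈xs))
  ... | here refl = ⊥-elim (All.lookup x≢xs z∈xs refl)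
  ... | there z∈  = z∈

map-++-inv : (f : A → B) (zs : List A) (xs : List B) {ys : List B} → xs ++ ys ≡ map f zs →
             ∃₂ λ as bs → zs ≡ as ++ bs × xs ≡ map f as × ys ≡ map f bs
map-++-inv f zs       []       eq = [] , zs , refl , refl , eq
map-++-inv f (z ∷ zs) (x ∷ xs) eq with map-++-inv f zs xs (∷-injectiveʳ eq)
... | as , bs , refl , refl , refl = z ∷ as , bs , refl , cong (_∷ map f as) (∷-injectiveˡ eq) , refl

total-∷= : (f : A → ℕ) (xs : List A) (k : Fin (length xs)) (w : A) → total f (xs [ k ]∷= w) ≤ f w + total f xs
total-∷= f (x ∷ xs) zero    w = +-monoʳ-≤ (f w) (m≤n+m (total f xs) (f x))
total-∷= f (x ∷ xs) (suc k) w = begin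
  f x + total f (xs [ k ]∷= w)   ≤⟨ +-monoʳ-≤ (f x) (total-∷= f xs k w) ⟩
  f x + (f w + total f xs)       ≡⟨ lemma (f x) (f w) _ ⟩
  f w + (f x + total f xs)       ∎
  where
  open ≤-Reasoning
  lemma : ∀ a b c → a + (b + c) ≡ b + (a + c)
  lemma = solve-∀

Unique-++⁻ʳ : (xs : List A) {ys : List A} → Unique (xs ++ ys) → Unique ys
Unique-++⁻ʳ []       u       = u
Unique-++⁻ʳ (_ ∷ xs) (_ ∷ u) = Unique-++⁻ʳ xs u

-- Labelled memories: old and newborn blocks

blockItems : Block → ℕ
blockItems b = total wordCost (words b)

LMemory : Set
LMemory = List (Bool × Block)

unlabel : LMemory → Memory
unlabel = map proj₂

label : Bool → Memory → LMemory
label l = map (l ,_)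

unlabel-label : ∀ l m → unlabel (label l m) ≡ m
unlabel-label l m = trans (sym (map-∘ m)) (map-id m)

total-label : ∀ f l m → total f (label l m) ≡ total (λ b → f (l , b)) m
total-label f l m = total-map f (l ,_) m

-- The label true marks the blocks allocated since the labelling began.
data LStep : LMemory → LMemory → ℕ → Set where
  write : ∀ {lm l b rest} (k : Fin (length (words b))) (w : Word) →
          lm ↭ (l , b) ∷ rest →
          LStep lm ((l , block (bid b) (words b [ k ]∷= w)) ∷ rest) (wordCost w)
  alloc : ∀ {lm rest} (srcs : LMemory) (newId e : ℕ) →
          lm ↭ srcs ++ rest → newId ∉ bids (unlabel lm) →
          LStep lm ((true , block newId (concatMap words (unlabel srcs) ++ replicate e empty)) ∷ rest)
                (itemCount (unlabel srcs))
  release : ∀ {lm x rest} → lm ↭ x ∷ rest → LStep lm rest 0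

lift-step : ∀ {n bound m m′ c} lm → unlabel lm ≡ m → Step n bound m m′ c →
            ∃ λ lm′ → unlabel lm′ ≡ m′ × LStep lm lm′ c
lift-step lm refl (write b k w _ p) with Perm.↭-map-inv proj₂ p
... | _ ∷ _ , refl , q = _ , refl , write k w q
lift-step lm refl (alloc srcs newId e p fresh _) with Perm.↭-map-inv proj₂ p
... | lm₁ , eq , q with map-++-inv proj₂ lm₁ srcs eq
...   | lsrcs , _ , refl , refl , refl = _ , refl , alloc lsrcs newId e q fresh
lift-step lm refl (release b p) with Perm.↭-map-inv proj₂ p
... | _ ∷ _ , refl , q = _ , refl , release q

-- The running cost `k` starts at an arbitrary value, so the same induction serves a single grow
-- operation, where it starts at 0, and an execution that continues from an earlier cost.
steps-invariant : (P : LMemory → ℕ → Set) →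
                  (∀ {lm lm′ k c} → LStep lm lm′ c → P lm k → P lm′ (k + c)) →
                  ∀ {n bound m m′ c} → Steps n bound m m′ c →
                  ∀ lm k → unlabel lm ≡ m → P lm k → ∃ λ lm′ → unlabel lm′ ≡ m′ × P lm′ (k + c)
steps-invariant P preserve done lm k eq h = lm , eq , subst (P lm) (sym (+-identityʳ k)) h
steps-invariant P preserve (_∷ˢ_ {c = c} {c′ = c′} st sts) lm k eq h with lift-step lm eq st
... | lm₁ , eq₁ , lst with steps-invariant P preserve sts lm₁ (k + c) eq₁ (preserve lst h)
...   | lm₂ , eq₂ , h₂ = lm₂ , eq₂ , subst (P lm₂) (+-assoc k c c′) h₂

onOld onNew : (Block → ℕ) → Bool × Block → ℕ
onOld f (true  , _) = 0
onOld f (false , b) = f b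
onNew f (true  , b) = f b
onNew f (false , _) = 0

onOld+onNew : ∀ f x → onOld f x + onNew f x ≡ f (proj₂ x)
onOld+onNew f (true  , b) = refl
onOld+onNew f (false , b) = +-identityʳ (f b)

-- A write keeps the length of its block, and an allocated block counts as new even when it is
-- filled from old ones. Hence old blocks can only disappear, and `f` need not be monotone.
LStep-old : ∀ (f : ℕ → ℕ) {lm lm′ c} → LStep lm lm′ c →
            total (onOld (f ∘ blockLen)) lm′ ≤ total (onOld (f ∘ blockLen)) lm
LStep-old f {lm} (write {l = l} {b} {rest} k w p) = ≤-reflexive (trans
  (cong (_+ total g rest) (lemma l)) (sym (total-↭ g p)))
  where
  g = onOld (f ∘ blockLen)
  lemma : ∀ l → g (l , block (bid b) (words b [ k ]∷= w)) ≡ g (l , b)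
  lemma true  = refl
  lemma false = cong f (length-∷= (words b) k w)
LStep-old f {lm} (alloc {rest = rest} srcs newId e p _) = begin
  total g rest                   ≤⟨ m≤n+m _ (total g srcs) ⟩
  total g srcs + total g rest    ≡⟨ total-++ g srcs rest ⟨
  total g (srcs ++ rest)         ≡⟨ total-↭ g p ⟨
  total g lm                     ∎
  where
  open ≤-Reasoning
  g = onOld (f ∘ blockLen)
LStep-old f {lm} (release {x = x} {rest} p) =
  ≤-trans (m≤n+m _ (g x)) (≤-reflexive (sym (total-↭ g p)))
  where g = onOld (f ∘ blockLen)

total-empty : ∀ e → total wordCost (replicate e empty) ≡ 0
total-empty zero    = refl
total-empty (suc e) = total-empty e

-- The items of an allocated block are exactly the items of its sources, each paid for by this step,
-- whether the sources were old or new.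
LStep-new : ∀ {lm lm′ c} → LStep lm lm′ c →
            total (onNew blockItems) lm′ ≤ total (onNew blockItems) lm + c
LStep-new {lm} (write {l = l} {b} {rest} k w p) = begin
  g (l , block (bid b) (words b [ k ]∷= w)) + total g rest  ≤⟨ +-monoˡ-≤ _ (lemma l) ⟩
  wordCost w + g (l , b) + total g rest                     ≡⟨ shuffle (wordCost w) _ _ ⟩
  g (l , b) + total g rest + wordCost w                     ≡⟨ cong (_+ wordCost w) (total-↭ g p) ⟨
  total g lm + wordCost w                                   ∎
  where
  open ≤-Reasoning
  g = onNew blockItems
  lemma : ∀ l → g (l , block (bid b) (words b [ k ]∷= w)) ≤ wordCost w + g (l , b)
  lemma true  = total-∷= wordCost (words b) k w
  lemma false = z≤n
  shuffle : ∀ a b c → a + b + c ≡ b + c + a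
  shuffle = solve-∀
LStep-new {lm} (alloc {rest = rest} srcs newId e p _) = begin
  total wordCost (concatMap words (unlabel srcs) ++ replicate e empty) + total g rest
    ≡⟨ cong (_+ total g rest) (trans (total-++ wordCost (concatMap words (unlabel srcs)) _)
         (trans (cong (itemCount (unlabel srcs) +_) (total-empty e)) (+-identityʳ _))) ⟩
  itemCount (unlabel srcs) + total g rest
    ≡⟨ +-comm (itemCount (unlabel srcs)) _ ⟩
  total g rest + itemCount (unlabel srcs)
    ≤⟨ +-monoˡ-≤ _ (m≤n+m _ (total g srcs)) ⟩
  total g srcs + total g rest + itemCount (unlabel srcs)
    ≡⟨ cong (_+ itemCount (unlabel srcs)) (total-++ g srcs rest) ⟨
  total g (srcs ++ rest) + itemCount (unlabel srcs)
    ≡⟨ cong (_+ itemCount (unlabel srcs)) (total-↭ g p) ⟨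
  total g lm + itemCount (unlabel srcs) ∎
  where
  open ≤-Reasoning
  g = onNew blockItems
LStep-new {lm} (release {x = x} {rest} p) =
  ≤-trans (m≤n+m _ (g x)) (≤-reflexive (sym (trans (+-identityʳ _) (total-↭ g p))))
  where g = onNew blockItems

new? : (Block → A) → Bool × Block → Maybe A
new? f (true  , b) = just (f b)
new? f (false , _) = nothing

newOf : (Block → A) → LMemory → List A
newOf f = mapMaybe (new? f)

total-newOf : (g : A → ℕ) (f : Block → A) (lm : LMemory) → total g (newOf f lm) ≡ total (onNew (g ∘ f)) lm
total-newOf g f []                = refl
total-newOf g f ((true  , b) ∷ lm) = cong (g (f b) +_) (total-newOf g f lm)
total-newOf g f ((false , b) ∷ lm) = total-newOf g f lm

∈-newOf⁻ : (f : Block → A) (lm : LMemory) {x : A} → x ∈ newOf f lm → ∃ λ b → b ∈ unlabel lm × x ≡ f b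
∈-newOf⁻ f ((true  , b) ∷ lm) (here eq) = b , here refl , eq
∈-newOf⁻ f ((true  , b) ∷ lm) (there p) = map₂ (map₁ there) (∈-newOf⁻ f lm p)
∈-newOf⁻ f ((false , b) ∷ lm) p         = map₂ (map₁ there) (∈-newOf⁻ f lm p)

newIds : LMemory → List ℕ
newIds = newOf bid

newIds-∷-cong : ∀ {l b b′ lm} → bid b ≡ bid b′ → newIds ((l , b) ∷ lm) ≡ newIds ((l , b′) ∷ lm)
newIds-∷-cong {true}  eq = cong (_∷ _) eq
newIds-∷-cong {false} eq = refl

newIds-↭ : ∀ {lm lm′} → lm ↭ lm′ → Unique (newIds lm) → Unique (newIds lm′)
newIds-↭ p = Unique-resp-↭ (setoid ℕ) (↭⇒↭ₛ (Perm.mapMaybe-↭ (new? bid) p))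

-- Freshness at allocation keeps the identifiers of newborn blocks distinct. This is what forces
-- different blocks to be reached by different pointer words.
LStep-newIds : ∀ {lm lm′ c} → LStep lm lm′ c → Unique (newIds lm) → Unique (newIds lm′)
LStep-newIds (write {l = l} {b} {rest} k w p) u =
  subst Unique (newIds-∷-cong {l} {b} {_} {rest} refl) (newIds-↭ p u)
LStep-newIds {lm} (alloc {rest = rest} srcs newId e p fresh) u =
  All.tabulate (λ {i} i∈rest newId≡i → fresh (subst (_∈ bids (unlabel lm)) (sym newId≡i) (old i∈rest)))
  ∷ Unique-++⁻ʳ (newIds srcs) (subst Unique (mapMaybe-++ (new? bid) srcs rest) (newIds-↭ p u))
  where
  old : ∀ {i} → i ∈ newIds rest → i ∈ bids (unlabel lm)
  old i∈rest with ∈-newOf⁻ bid rest i∈rest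
  ... | b , b∈rest , refl = ∈-map⁺ bid (Perm.∈-resp-↭ (↭-sym (Perm.map⁺ proj₂ p))
    (subst (b ∈_) (sym (map-++ proj₂ srcs rest)) (∈-++⁺ʳ (unlabel srcs) b∈rest)))
LStep-newIds (release {x = x} {rest} p) u =
  Unique-++⁻ʳ (newIds (x ∷ [])) (subst Unique (mapMaybe-++ (new? bid) (x ∷ []) rest) (newIds-↭ p u))

-- Counting items, pointers and blocks in a represented array

ptrCost : Word → ℕ
ptrCost (ptr _) = 1
ptrCost _       = 0

blockPtrs : Block → ℕ
blockPtrs b = total ptrCost (words b)

items+ptrs≤len : ∀ b → blockItems b + blockPtrs b ≤ blockLen b
items+ptrs≤len b = begin
  blockItems b + blockPtrs b                          ≡⟨ total-+ wordCost ptrCost (words b) ⟨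
  total (λ w → wordCost w + ptrCost w) (words b)      ≤⟨ total-mono one (words b) ⟩
  total (λ _ → 1) (words b)                           ≡⟨ total-const 1 (words b) ⟩
  blockLen b * 1                                      ≡⟨ *-identityʳ _ ⟩
  blockLen b                                          ∎
  where
  open ≤-Reasoning
  one : ∀ w → wordCost w + ptrCost w ≤ 1
  one (item _) = ≤-refl
  one (ptr _)  = ≤-refl
  one empty    = z≤n

items≤len : ∀ b → blockItems b ≤ blockLen b
items≤len b = m+n≤o⇒m≤o (blockItems b) (items+ptrs≤len b)

module _ {s : ℕ → ℕ} {n : ℕ} {m : Memory} (rep : Represents s n m) where

  represents-items : n ≤ total blockItems m
  represents-items = begin
    n                                     ≡⟨ trans (*-identityʳ _) (length-upTo n) ⟨
    length (upTo n) * 1                   ≡⟨ total-const 1 (upTo n) ⟨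
    total (λ _ → 1) (upTo n)              ≡⟨ total-map wordCost item (upTo n) ⟨
    total wordCost (map item (upTo n))    ≤⟨ total-⊆ wordCost (Unique.map⁺ (λ { refl → refl }) (Unique.upTo⁺ n)) stored ⟩
    total wordCost (concatMap words m)    ≡⟨ total-concatMap wordCost words m ⟩
    total blockItems m                    ∎
    where
    open ≤-Reasoning
    stored : ∀ {w} → w ∈ map item (upTo n) → w ∈ concatMap words m
    stored w∈ with ∈-map⁻ item w∈
    ... | i , i∈ , refl = ∈-concatMap⁺ words (proj₁ rep i (∈-upTo⁻ i∈))

  represents-space : total blockLen m ≤ n + s n
  represents-space = proj₂ (proj₂ rep)

  -- The items occupy at least `n` of the `n + s n` words, which leaves at most `s n` words for
  -- pointers.
  represents-ptrs : total blockPtrs m ≤ s n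
  represents-ptrs = +-cancelˡ-≤ n _ _ (begin
    n + total blockPtrs m                             ≤⟨ +-monoˡ-≤ _ represents-items ⟩
    total blockItems m + total blockPtrs m            ≡⟨ total-+ blockItems blockPtrs m ⟨
    total (λ b → blockItems b + blockPtrs b) m        ≤⟨ total-mono items+ptrs≤len m ⟩
    total blockLen m                                  ≤⟨ represents-space ⟩
    n + s n                                           ∎)
    where open ≤-Reasoning

  -- Distinct identifiers require distinct pointer words. The main block may lack a pointer, so
  -- `ptr (bid main)` is added to the words of the memory; this is the `suc`.
  represents-newIds : ∀ lm → unlabel lm ≡ m → Unique (newIds lm) → length (newIds lm) ≤ suc (s n)
  represents-newIds lm refl u = begin
    length (newIds lm)                          ≡⟨ *-identityʳ _ ⟨
    length (newIds lm) * 1                      ≡⟨ total-const 1 (newIds lm) ⟨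
    total (λ _ → 1) (newIds lm)                 ≡⟨ total-map ptrCost ptr (newIds lm) ⟨
    total ptrCost (map ptr (newIds lm))         ≤⟨ total-⊆ ptrCost (Unique.map⁺ (λ { refl → refl }) u) pointed ⟩
    suc (total ptrCost (concatMap words m))     ≡⟨ cong suc (total-concatMap ptrCost words m) ⟩
    suc (total blockPtrs m)                     ≤⟨ s≤s represents-ptrs ⟩
    suc (s n)                                   ∎
    where
    open ≤-Reasoning
    main = proj₁ (proj₁ (proj₂ rep))
    pointed : ∀ {w} → w ∈ map ptr (newIds lm) → w ∈ ptr (bid main) ∷ concatMap words m
    pointed w∈ with ∈-map⁻ ptr w∈
    ... | i , i∈ , refl with ∈-newOf⁻ bid lm i∈
    ...   | b , b∈ , refl with All.lookup (proj₂ (proj₂ (proj₁ (proj₂ rep)))) b∈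
    ...     | inj₁ refl = here refl
    ...     | inj₂ p    = there (∈-concatMap⁺ words p)

total-unlabel : ∀ f lm → total f (unlabel lm) ≡ total (onOld f) lm + total (onNew f) lm
total-unlabel f lm = begin
  total f (unlabel lm)                      ≡⟨ total-map f proj₂ lm ⟩
  total (f ∘ proj₂) lm                      ≡⟨ cong sum (map-cong (onOld+onNew f) lm) ⟨
  total (λ x → onOld f x + onNew f x) lm    ≡⟨ total-+ (onOld f) (onNew f) lm ⟩
  total (onOld f) lm + total (onNew f) lm   ∎
  where open ≡-Reasoning

-- Newborn blocks of one grow operation, and the accounting of an execution

lens : Memory → List ℕ
lens = map blockLen

-- `born` consists of the newborn blocks still alive at the end. Their words are either items, paid
-- for by `c`, or among the at most `S` words of the final memory that hold no item.
born-in-grow : ∀ {n bound m₀ m c S} → Steps n bound m₀ m c →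
               n ≤ total blockItems m → total blockLen m ≤ n + S →
               ∃ λ born → (∀ f → total f (lens m) ≤ total f born + total f (lens m₀)) ×
                          total id born ≤ c + S
born-in-grow {n} {m₀ = m₀} {m} {c} {S} steps n≤items space≤
  with steps-invariant Inv preserve steps (label false m₀) 0 (unlabel-label false m₀) initially
  where
  Inv : LMemory → ℕ → Set
  Inv lm k = (∀ f → total (onOld (f ∘ blockLen)) lm ≤ total f (lens m₀)) × total (onNew blockItems) lm ≤ k
  preserve : ∀ {lm lm′ k c} → LStep lm lm′ c → Inv lm k → Inv lm′ (k + c)
  preserve {c = c} st (old , new) =
    (λ f → ≤-trans (LStep-old f st) (old f)) , ≤-trans (LStep-new st) (+-monoˡ-≤ c new)
  initially : Inv (label false m₀) 0
  initially =
    (λ f → ≤-reflexive (trans (total-label (onOld (f ∘ blockLen)) false m₀) (sym (total-map f blockLen m₀)))) ,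
    ≤-reflexive (trans (total-label (onNew blockItems) false m₀) (trans (total-const 0 m₀) (*-zeroʳ (length m₀))))
... | lm , refl , old , new = born , evolve , +-cancelʳ-≤ n _ _ (begin
    total id born + n                                        ≤⟨ +-mono-≤ (≤-reflexive (total-newOf id blockLen lm)) n≤items ⟩
    total (onNew blockLen) lm + total blockItems (unlabel lm)  ≡⟨ cong (total (onNew blockLen) lm +_) (total-map blockItems proj₂ lm) ⟩
    total (onNew blockLen) lm + total (blockItems ∘ proj₂) lm  ≡⟨ total-+ (onNew blockLen) (blockItems ∘ proj₂) lm ⟨
    total (λ x → onNew blockLen x + blockItems (proj₂ x)) lm  ≤⟨ total-mono slack lm ⟩
    total (λ x → onNew blockItems x + blockLen (proj₂ x)) lm  ≡⟨ total-+ (onNew blockItems) (blockLen ∘ proj₂) lm ⟩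
    total (onNew blockItems) lm + total (blockLen ∘ proj₂) lm ≡⟨ cong (total (onNew blockItems) lm +_) (total-map blockLen proj₂ lm) ⟨
    total (onNew blockItems) lm + total blockLen (unlabel lm) ≤⟨ +-mono-≤ new space≤ ⟩
    c + (n + S)                                              ≡⟨ shuffle c n S ⟩
    c + S + n                                                ∎)
  where
  open ≤-Reasoning
  born = newOf blockLen lm
  evolve : ∀ f → total f (lens (unlabel lm)) ≤ total f born + total f (lens m₀)
  evolve f = begin
    total f (lens (unlabel lm))                          ≡⟨ total-map f blockLen (unlabel lm) ⟩
    total (f ∘ blockLen) (unlabel lm)                    ≡⟨ total-unlabel (f ∘ blockLen) lm ⟩
    total (onOld (f ∘ blockLen)) lm + total h lm         ≤⟨ +-monoˡ-≤ _ (old f) ⟩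
    total f (lens m₀) + total h lm                       ≡⟨ +-comm (total f (lens m₀)) _ ⟩
    total h lm + total f (lens m₀)                       ≡⟨ cong (_+ total f (lens m₀)) (total-newOf f blockLen lm) ⟨
    total f born + total f (lens m₀)                     ∎
    where h = onNew (f ∘ blockLen)
  slack : ∀ x → onNew blockLen x + blockItems (proj₂ x) ≤ onNew blockItems x + blockLen (proj₂ x)
  slack (true  , b) = ≤-reflexive (+-comm (blockLen b) _)
  slack (false , b) = items≤len b
  shuffle : ∀ a b c → a + (b + c) ≡ a + c + b
  shuffle = solve-∀

-- Only the blocks of the initial memory may share identifiers, and only their items have not been paid for.
Accounted : ℕ → Memory → ℕ → Set
Accounted s₀ m c = ∃ λ lm → unlabel lm ≡ m × total (onOld blockLen) lm ≤ s₀ ×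
                   total (onNew blockItems) lm ≤ c × Unique (newIds lm)

accounted-start : ∀ {s m} → Represents s 0 m → Accounted (s 0) m 0
accounted-start {s} {m} rep = label false m , unlabel-label false m ,
    ≤-trans (≤-reflexive (total-label (onOld blockLen) false m)) (represents-space {s} rep) ,
    ≤-reflexive (trans (total-label (onNew blockItems) false m) (trans (total-const 0 m) (*-zeroʳ (length m)))) ,
    none m
  where
  none : ∀ m → Unique (newIds (label false m))
  none []      = []
  none (_ ∷ m) = none m

accounted-steps : ∀ {s₀ n bound m m′ c c′} → Steps n bound m m′ c′ → Accounted s₀ m c → Accounted s₀ m′ (c + c′)
accounted-steps {s₀} {c = c} steps (lm , eq , inv) = steps-invariant
  (λ lm k → total (onOld blockLen) lm ≤ s₀ × total (onNew blockItems) lm ≤ k × Unique (newIds lm))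
  (λ {c = c} st (old , new , u) →
    ≤-trans (LStep-old id st) old , ≤-trans (LStep-new st) (+-monoˡ-≤ c new) , LStep-newIds st u)
  steps lm c eq inv

onOld-mono : ∀ {f g} → (∀ b → f b ≤ g b) → ∀ x → onOld f x ≤ onOld g x
onOld-mono f≤g (true  , b) = z≤n
onOld-mono f≤g (false , b) = f≤g b

onNew-mono : ∀ {f g} → (∀ b → f b ≤ g b) → ∀ x → onNew f x ≤ onNew g x
onNew-mono f≤g (true  , b) = f≤g b
onNew-mono f≤g (false , b) = z≤n

accounted-items : ∀ {s₀ m c} → Accounted s₀ m c → total blockItems m ≤ s₀ + c
accounted-items {s₀} {c = c} (lm , refl , old , new , _) = begin
  total blockItems (unlabel lm)                              ≡⟨ total-unlabel blockItems lm ⟩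
  total (onOld blockItems) lm + total (onNew blockItems) lm  ≤⟨ +-mono-≤ (total-mono (onOld-mono items≤len) lm) new ⟩
  total (onOld blockLen) lm + c                              ≤⟨ +-monoˡ-≤ c old ⟩
  s₀ + c                                                     ∎
  where open ≤-Reasoning

-- Newborn blocks are counted by their identifiers. Initial blocks may share identifiers and are
-- counted by their space instead, which bounds the nonempty ones only; hence the weight `1 ⊓_`.
-- Empty blocks hold no items.
accounted-blocks : ∀ {s n m s₀ c} → Represents s n m → Accounted s₀ m c →
                   total (1 ⊓_) (lens m) ≤ s₀ + suc (s n)
accounted-blocks {s} {n} {m} {s₀} rep (lm , refl , old , _ , u) = begin
  total (1 ⊓_) (lens m)                   ≡⟨ total-map (1 ⊓_) blockLen m ⟩
  total one m                             ≡⟨ total-unlabel one lm ⟩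
  total (onOld one) lm + total (onNew one) lm
    ≤⟨ +-mono-≤ (≤-trans (total-mono (onOld-mono (λ b → m⊓n≤n 1 (blockLen b))) lm) old)
                (total-mono (onNew-mono (λ b → m⊓n≤m 1 (blockLen b))) lm) ⟩
  s₀ + total (onNew (λ _ → 1)) lm         ≡⟨ cong (s₀ +_) (total-newOf (λ _ → 1) bid lm) ⟨
  s₀ + total (λ _ → 1) (newIds lm)        ≡⟨ cong (s₀ +_) (trans (total-const 1 (newIds lm)) (*-identityʳ _)) ⟩
  s₀ + length (newIds lm)                 ≤⟨ +-monoʳ-≤ s₀ (represents-newIds {s} rep lm refl u) ⟩
  s₀ + suc (s n)                          ∎
  where
  open ≤-Reasoning
  one : Block → ℕ
  one b = 1 ⊓ blockLen b

-- Long newborn blocks, and the trace of an execution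

small large : ℕ → ℕ → ℕ
small T L with T ≤? L
... | yes _ = 0
... | no  _ = L
large T L with T ≤? L
... | yes _ = L
... | no  _ = 0

large-≥ : ∀ {T L} → T ≤ L → large T L ≡ L
large-≥ {T} {L} T≤L with T ≤? L
... | yes _   = refl
... | no  T≰L = contradiction T≤L T≰L

large-< : ∀ {T L} → L < T → large T L ≡ 0
large-< {T} {L} L<T with T ≤? L
... | yes T≤L = contradiction T≤L (<⇒≱ L<T)
... | no  _   = refl

small-≥ : ∀ {T L} → T ≤ L → small T L ≡ 0
small-≥ {T} {L} T≤L with T ≤? L
... | yes _   = refl
... | no  T≰L = contradiction T≤L T≰L

small≤ : ∀ T L → small T L ≤ L
small≤ T L with T ≤? L
... | yes _ = z≤n
... | no  _ = ≤-refl

small+large : ∀ T L → small T L + large T L ≡ L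
small+large T L with T ≤? L
... | yes _ = refl
... | no  _ = +-identityʳ L

large≤ : ∀ T L → large T L ≤ L
large≤ T L with T ≤? L
... | yes _ = ≤-refl
... | no  _ = z≤n

total-large : ∀ T Ls → total (large T) Ls ≡ 0 ⊎ T ≤ total (large T) Ls
total-large T []       = inj₁ refl
total-large T (L ∷ Ls) with T ≤? L
... | yes T≤L = inj₂ (≤-trans T≤L (m≤m+n L _))
... | no  _   = total-large T Ls

-- If some block has length at least `W`, the sum `x` of the long lengths satisfies `S + S ≤ x` and
-- `x ≤ c + S`. Doubling the second inequality absorbs the slack: `x + x ≤ 2 * c + x`.
large-paid : ∀ {W S c} Ls → S + S ≤ W → total id Ls ≤ c + S → total (large W) Ls ≤ 2 * c
large-paid {W} {S} {c} Ls 2S≤W Ls≤ with total-large W Ls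
... | inj₁ eq   = ≤-trans (≤-reflexive eq) z≤n
... | inj₂ W≤ = +-cancelʳ-≤ x _ _ (begin
    x + x                  ≤⟨ +-mono-≤ x≤ x≤ ⟩
    c + S + (c + S)        ≡⟨ shuffle c S ⟩
    2 * c + (S + S)        ≤⟨ +-monoʳ-≤ (2 * c) (≤-trans 2S≤W W≤) ⟩
    2 * c + x              ∎)
  where
  open ≤-Reasoning
  x = total (large W) Ls
  x≤ : x ≤ c + S
  x≤ = ≤-trans (total-mono (large≤ W) Ls) Ls≤
  shuffle : ∀ c S → c + S + (c + S) ≡ 2 * c + (S + S)
  shuffle = solve-∀

-- hist t lists the lengths of all blocks that survived the grow operation, among the first t, that allocated them.
record Trace (S n W c : ℕ) : Set where
  field
    sizes hist : ℕ → List ℕ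
    lower  : ∀ {t} → t ≤ n → t ≤ total id (sizes t)
    upper  : ∀ {t} → t ≤ n → total id (sizes t) ≤ t + S
    few    : ∀ {t} → t ≤ n → total (1 ⊓_) (sizes t) ≤ suc (S + S)
    evolve : ∀ {u t} → u ≤ t → t ≤ n → ∃ λ born → hist t ≡ born ++ hist u ×
             (∀ f → total f (sizes t) ≤ total f born + total f (sizes u))
    paid   : total (large W) (hist n) ≤ 2 * c

extend : ∀ {A : Set} → ℕ → (ℕ → A) → A → ℕ → A
extend n f x t with t ≤? n
... | yes _ = f t
... | no  _ = x

extend-≤ : ∀ {A : Set} {n t} (f : ℕ → A) x → t ≤ n → extend n f x t ≡ f t
extend-≤ {n = n} {t} f x t≤n with t ≤? n
... | yes _   = refl
... | no  t≰n = contradiction t≤n t≰n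

extend-suc : ∀ {A : Set} n (f : ℕ → A) x → extend n f x (suc n) ≡ x
extend-suc n f x with suc n ≤? n
... | yes n<n = contradiction n<n 1+n≰n
... | no  _   = refl

module _ {S n W c : ℕ} (2S≤W : S + S ≤ W) (tr : Trace S n W c) where
  open Trace tr

  trace-snoc : ∀ {Ls born c′} → suc n ≤ total id Ls → total id Ls ≤ suc n + S →
               total (1 ⊓_) Ls ≤ suc (S + S) →
               (∀ f → total f Ls ≤ total f born + total f (sizes n)) → total id born ≤ c′ + S →
               ∃ λ (tr′ : Trace S (suc n) W (c + c′)) → Trace.sizes tr′ (suc n) ≡ Ls
  trace-snoc {Ls} {born} {c′} lower′ upper′ few′ evolve′ born≤ = record
    { sizes = sizes⁺ ; hist = hist⁺
    ; lower  = λ {t} t≤ → by-cases (λ t Ls → t ≤ total id Ls) lower lower′ t≤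
    ; upper  = λ {t} t≤ → by-cases (λ t Ls → total id Ls ≤ t + S) upper upper′ t≤
    ; few    = λ {t} t≤ → by-cases (λ t Ls → total (1 ⊓_) Ls ≤ suc (S + S)) few few′ t≤
    ; evolve = evolve⁺
    ; paid   = begin
        total (large W) (hist⁺ (suc n))                    ≡⟨ cong (total (large W)) (extend-suc n hist _) ⟩
        total (large W) (born ++ hist n)                   ≡⟨ total-++ (large W) born (hist n) ⟩
        total (large W) born + total (large W) (hist n)    ≤⟨ +-mono-≤ (large-paid {c = c′} born 2S≤W born≤) paid ⟩
        2 * c′ + 2 * c                                     ≡⟨ shuffle c′ c ⟩
        2 * (c + c′)                                       ∎
    } , extend-suc n sizes Ls
    where
    open ≤-Reasoning
    sizes⁺ = extend n sizes Ls
    hist⁺ = extend n hist (born ++ hist n)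
    shuffle : ∀ a b → 2 * a + 2 * b ≡ 2 * (b + a)
    shuffle = solve-∀
    by-cases : (P : ℕ → List ℕ → Set) → (∀ {t} → t ≤ n → P t (sizes t)) → P (suc n) Ls →
               ∀ {t} → t ≤ suc n → P t (sizes⁺ t)
    by-cases P before now t≤ with m≤n⇒m<n∨m≡n t≤
    ... | inj₁ (s≤s t≤n) = subst (P _) (sym (extend-≤ sizes Ls t≤n)) (before t≤n)
    ... | inj₂ refl      = subst (P _) (sym (extend-suc n sizes Ls)) now
    Evolves : (Lt Ht Lu Hu : List ℕ) → Set
    Evolves Lt Ht Lu Hu = ∃ λ born → Ht ≡ born ++ Hu × (∀ f → total f Lt ≤ total f born + total f Lu)
    evolve⁺ : ∀ {u t} → u ≤ t → t ≤ suc n → Evolves (sizes⁺ t) (hist⁺ t) (sizes⁺ u) (hist⁺ u)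
    evolve⁺ {u} {t} u≤t t≤ with m≤n⇒m<n∨m≡n t≤ | m≤n⇒m<n∨m≡n u≤t
    ... | _ | inj₂ refl = [] , refl , λ f → ≤-refl
    ... | inj₁ (s≤s t≤n) | _
      rewrite extend-≤ sizes Ls t≤n | extend-≤ hist (born ++ hist n) t≤n
            | extend-≤ sizes Ls (≤-trans u≤t t≤n) | extend-≤ hist (born ++ hist n) (≤-trans u≤t t≤n)
      = evolve u≤t t≤n
    ... | inj₂ refl | inj₁ (s≤s u≤n)
      rewrite extend-suc n sizes Ls | extend-suc n hist (born ++ hist n)
            | extend-≤ sizes Ls u≤n | extend-≤ hist (born ++ hist n) u≤n
      with evolve u≤n ≤-refl
    ...   | born₀ , eq , below = born ++ born₀ , trans (cong (born ++_) eq) (sym (++-assoc born born₀ (hist u))) ,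
        λ f → begin
          total f Ls                                            ≤⟨ evolve′ f ⟩
          total f born + total f (sizes n)                      ≤⟨ +-monoʳ-≤ (total f born) (below f) ⟩
          total f born + (total f born₀ + total f (sizes u))    ≡⟨ +-assoc (total f born) _ _ ⟨
          total f born + total f born₀ + total f (sizes u)      ≡⟨ cong (_+ total f (sizes u)) (total-++ f born born₀) ⟨
          total f (born ++ born₀) + total f (sizes u)           ∎

accounted : ∀ {s n m c} → GrowExec s n m c → Represents s n m × Accounted (s 0) m c
accounted {s} (start rep) = rep , accounted-start {s} rep
accounted (grow ex steps rep) = rep , accounted-steps steps (proj₂ (accounted ex))

items-paid : ∀ {s n m c} → GrowExec s n m c → n ≤ s 0 + c
items-paid {s} ex with accounted ex
... | rep , acc = ≤-trans (represents-items {s} rep) (accounted-items acc)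

-- The equation with `lens m` ties the end of the trace to the actual memory, from which the next
-- grow operation extends it.
trace : ∀ {s n m c S W} → GrowExec s n m c → (∀ {t} → t ≤ n → s t ≤ S) → S + S ≤ W →
        ∃ λ (tr : Trace S n W c) → Trace.sizes tr n ≡ lens m
trace {s} {S = S} {W} ex@(start {m} rep) s≤S 2S≤W = record
    { sizes  = λ _ → lens m
    ; hist   = λ _ → []
    ; lower  = λ { z≤n → z≤n }
    ; upper  = λ { z≤n → ≤-trans (≤-reflexive (total-map id blockLen m))
                                 (≤-trans (represents-space {s} rep) (s≤S z≤n)) }
    ; few    = λ _ → few₀
    ; evolve = λ _ _ → [] , refl , λ f → ≤-refl
    ; paid   = z≤n
    } , refl
  where
  few₀ : total (1 ⊓_) (lens m) ≤ suc (S + S)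
  few₀ = ≤-trans (accounted-blocks {s} rep (proj₂ (accounted ex)))
           (≤-trans (+-mono-≤ (s≤S z≤n) (s≤s (s≤S z≤n))) (≤-reflexive (+-suc S S)))
trace {s} {suc n} {S = S} {W} ex′@(grow {m = m} {m′} ex steps rep) s≤S 2S≤W
  with trace {W = W} ex (s≤S ∘ m≤n⇒m≤1+n) 2S≤W
... | tr , eq with born-in-grow {S = S} steps (represents-items {s} rep)
                     (≤-trans (represents-space {s} rep) (+-monoʳ-≤ (suc n) (s≤S ≤-refl)))
... | born , evolve , born≤ = trace-snoc 2S≤W tr {born = born}
    (begin
      suc n                  ≤⟨ represents-items {s} rep ⟩
      total blockItems m′    ≤⟨ total-mono items≤len m′ ⟩
      total blockLen m′      ≡⟨ total-map id blockLen m′ ⟨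
      total id (lens m′)     ∎)
    (begin
      total id (lens m′)     ≡⟨ total-map id blockLen m′ ⟩
      total blockLen m′      ≤⟨ represents-space {s} rep ⟩
      suc n + s (suc n)      ≤⟨ +-monoʳ-≤ (suc n) (s≤S ≤-refl) ⟩
      suc n + S              ∎)
    (begin
      total (1 ⊓_) (lens m′)  ≤⟨ accounted-blocks {s} rep (proj₂ (accounted ex′)) ⟩
      s 0 + suc (s (suc n))   ≤⟨ +-mono-≤ (s≤S z≤n) (s≤s (s≤S ≤-refl)) ⟩
      S + suc S               ≡⟨ +-suc S S ⟩
      suc (S + S)             ∎)
    (λ f → subst (λ Ls → total f (lens m′) ≤ total f born + total f Ls) (sym eq) (evolve f))
    born≤
  where open ≤-Reasoning

-- Sums over times and levels

sumTo : ℕ → (ℕ → ℕ) → ℕ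
sumTo zero    f = 0
sumTo (suc n) f = f 0 + sumTo n (f ∘ suc)

sumTo-mono : ∀ n {f g} → (∀ i → i < n → f i ≤ g i) → sumTo n f ≤ sumTo n g
sumTo-mono zero    f≤g = z≤n
sumTo-mono (suc n) f≤g = +-mono-≤ (f≤g 0 (s≤s z≤n)) (sumTo-mono n (λ i i<n → f≤g (suc i) (s≤s i<n)))

sumTo-const : ∀ n k → sumTo n (λ _ → k) ≡ n * k
sumTo-const zero    k = refl
sumTo-const (suc n) k = cong (k +_) (sumTo-const n k)

sumTo-* : ∀ n k f → sumTo n (λ i → k * f i) ≡ k * sumTo n f
sumTo-* zero    k f = sym (*-zeroʳ k)
sumTo-* (suc n) k f = trans (cong (k * f 0 +_) (sumTo-* n k (f ∘ suc))) (sym (*-distribˡ-+ k (f 0) _))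

sumTo-+ : ∀ n f g → sumTo n (λ i → f i + g i) ≡ sumTo n f + sumTo n g
sumTo-+ zero    f g = refl
sumTo-+ (suc n) f g = trans (cong (f 0 + g 0 +_) (sumTo-+ n (f ∘ suc) (g ∘ suc))) (+-interchange (f 0) (g 0) _ _)

sumTo-last : ∀ n f → sumTo (suc n) f ≡ sumTo n f + f n
sumTo-last zero    f = +-identityʳ (f 0)
sumTo-last (suc n) f = trans (cong (f 0 +_) (sumTo-last n (f ∘ suc))) (sym (+-assoc (f 0) _ _))

sumTo-total : ∀ {A : Set} n (f : ℕ → A → ℕ) xs →
              sumTo n (λ i → total (f i) xs) ≡ total (λ x → sumTo n (λ i → f i x)) xs
sumTo-total zero    f xs = sym (trans (total-const 0 xs) (*-zeroʳ (length xs)))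
sumTo-total (suc n) f xs = trans (cong (total (f 0) xs +_) (sumTo-total n (f ∘ suc) xs))
  (sym (total-+ (f 0) (λ x → sumTo n (λ i → f (suc i) x)) xs))

sumTo-swap : ∀ n m (f : ℕ → ℕ → ℕ) →
             sumTo n (λ i → sumTo m (f i)) ≡ sumTo m (λ j → sumTo n (λ i → f i j))
sumTo-swap zero    m f = sym (trans (sumTo-const m 0) (*-zeroʳ m))
sumTo-swap (suc n) m f = trans (cong (sumTo m (f 0) +_) (sumTo-swap n m (f ∘ suc)))
  (sym (sumTo-+ m (f 0) (λ j → sumTo n (λ i → f (suc i) j))))

-- Each shift by one drops the first term and adds one at the end, so `T` shifts gain at most
-- `T * B`. This replaces telescoping with subtraction.
sumTo-shift : ∀ M T (a : ℕ → ℕ) {B} → (∀ t → t ≤ T + M → a t ≤ B) →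
              sumTo M (λ i → a (T + i)) ≤ sumTo M a + T * B
sumTo-shift M zero    a     a≤B = m≤m+n _ 0
sumTo-shift M (suc T) a {B} a≤B = begin
  sumTo M (λ i → a (suc T + i))        ≤⟨ sumTo-shift M T (a ∘ suc) (λ t t≤ → a≤B (suc t) (s≤s t≤)) ⟩
  sumTo M (a ∘ suc) + T * B            ≤⟨ +-monoˡ-≤ _ (m≤n+m _ (a 0)) ⟩
  sumTo (suc M) a + T * B              ≡⟨ cong (_+ T * B) (sumTo-last M a) ⟩
  sumTo M a + a M + T * B              ≤⟨ +-monoˡ-≤ _ (+-monoʳ-≤ (sumTo M a) (a≤B M (m≤n+m M (suc T)))) ⟩
  sumTo M a + B + T * B                ≡⟨ +-assoc (sumTo M a) B _ ⟩
  sumTo M a + (B + T * B)              ∎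
  where open ≤-Reasoning

⊓-subadditive : ∀ a b c → (a + b) ⊓ c ≤ a ⊓ c + b ⊓ c
⊓-subadditive a b c with ≤-total c a | ≤-total c b
... | inj₁ c≤a | _ = ≤-trans (m⊓n≤n (a + b) c) (≤-trans (≤-reflexive (sym (m≥n⇒m⊓n≡n c≤a))) (m≤m+n _ _))
... | inj₂ _   | inj₁ c≤b = ≤-trans (m⊓n≤n (a + b) c) (≤-trans (≤-reflexive (sym (m≥n⇒m⊓n≡n c≤b))) (m≤n+m _ _))
... | inj₂ a≤c | inj₂ b≤c = ≤-trans (m⊓n≤m (a + b) c)
  (≤-reflexive (sym (cong₂ _+_ (m≤n⇒m⊓n≡m a≤c) (m≤n⇒m⊓n≡m b≤c))))

total-⊓ : ∀ {A : Set} (f : A → ℕ) c xs → total f xs ⊓ c ≤ total (λ x → f x ⊓ c) xs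
total-⊓ f c []       = z≤n
total-⊓ f c (x ∷ xs) = ≤-trans (⊓-subadditive (f x) _ c) (+-monoʳ-≤ (f x ⊓ c) (total-⊓ f c xs))

-- Capped weights and geometrically growing lengths

capped : ℕ → ℕ → ℕ → ℕ
capped T T′ L = large T L ⊓ T′

module Levels (b : ℕ) (2≤b : 2 ≤ b) where

  -- The recursion multiplies the starting length, so the levels of `W` after the first are the
  -- levels of `b * W`. Inductions on the number of levels can then generalise over `W`.
  level : ℕ → ℕ → ℕ
  level W zero    = W
  level W (suc j) = level (b * W) j

  level-^ : ∀ W j → level W j ≡ b ^ j * W
  level-^ W zero    = sym (*-identityˡ W)
  level-^ W (suc j) = trans (level-^ (b * W) j) (shuffle (b ^ j) b W)
    where
    shuffle : ∀ p b W → p * (b * W) ≡ b * p * W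
    shuffle = solve-∀

  level-top : ∀ W {j J} → j < J → b ^ (J ∸ suc j) * level W (suc j) ≡ level W J
  level-top W {j} {J} j<J = begin
    b ^ (J ∸ suc j) * level W (suc j)            ≡⟨ cong (b ^ (J ∸ suc j) *_) (level-^ W (suc j)) ⟩
    b ^ (J ∸ suc j) * (b ^ suc j * W)            ≡⟨ *-assoc (b ^ (J ∸ suc j)) (b ^ suc j) W ⟨
    b ^ (J ∸ suc j) * b ^ suc j * W              ≡⟨ cong (_* W) (^-distribˡ-+-* b (J ∸ suc j) (suc j)) ⟨
    b ^ (J ∸ suc j + suc j) * W                  ≡⟨ cong (λ k → b ^ k * W) (m∸n+n≡m j<J) ⟩
    b ^ J * W                                    ≡⟨ level-^ W J ⟨
    level W J                                    ∎
    where open ≡-Reasoning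

  2*≤ : ∀ x → 2 * x ≤ b * x
  2*≤ x = *-monoˡ-≤ x 2≤b

  ≤b* : ∀ x → x ≤ b * x
  ≤b* x = ≤-trans (m≤m+n x _) (2*≤ x)

  level≥ : ∀ W j → W ≤ level W j
  level≥ W zero    = ≤-refl
  level≥ W (suc j) = ≤-trans (≤b* W) (level≥ (b * W) j)

  sum-capped-< : ∀ J W L → L < W → sumTo J (λ j → capped (level W j) (level W (suc j)) L) ≡ 0
  sum-capped-< zero    W L L<W = refl
  sum-capped-< (suc J) W L L<W =
    cong₂ _+_ (cong (_⊓ (b * W)) (large-< L<W)) (sum-capped-< J (b * W) L (<-≤-trans L<W (≤b* W)))

  -- The surplus 2 * W makes the geometric series provable by induction.
  sum-capped-≥ : ∀ J W L → W ≤ L → sumTo J (λ j → capped (level W j) (level W (suc j)) L) + 2 * W ≤ 3 * L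
  sum-capped-≥ zero    W L W≤L = ≤-trans (*-monoʳ-≤ 2 W≤L) (*-monoˡ-≤ L {2} {3} (s≤s (s≤s z≤n)))
  sum-capped-≥ (suc J) W L W≤L with ≤-<-connex (b * W) L
  ... | inj₁ bW≤L = begin
    capped W (b * W) L + rest + 2 * W    ≤⟨ +-mono-≤ (+-monoˡ-≤ rest (m⊓n≤n (large W L) (b * W))) (2*≤ W) ⟩
    b * W + rest + b * W                 ≡⟨ shuffle (b * W) rest ⟩
    rest + 2 * (b * W)                   ≤⟨ sum-capped-≥ J (b * W) L bW≤L ⟩
    3 * L                                ∎
    where
    open ≤-Reasoning
    rest = sumTo J (λ j → capped (level (b * W) j) (level (b * W) (suc j)) L)
    shuffle : ∀ x r → x + r + x ≡ r + 2 * x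
    shuffle = solve-∀
  ... | inj₂ L<bW = begin
    capped W (b * W) L + rest + 2 * W    ≡⟨ cong (λ r → capped W (b * W) L + r + 2 * W) (sum-capped-< J (b * W) L L<bW) ⟩
    capped W (b * W) L + 0 + 2 * W       ≤⟨ +-mono-≤ (≤-trans (≤-reflexive (+-identityʳ _))
                                              (≤-trans (m⊓n≤m (large W L) (b * W)) (large≤ W L))) (*-monoʳ-≤ 2 W≤L) ⟩
    3 * L                                ∎
    where
    open ≤-Reasoning
    rest = sumTo J (λ j → capped (level (b * W) j) (level (b * W) (suc j)) L)

  -- The right side vanishes for `L < W`: only blocks of length at least `W` are charged, and only
  -- those are known to be paid for.
  sum-capped : ∀ J W L → sumTo J (λ j → capped (level W j) (level W (suc j)) L) ≤ 3 * large W L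
  sum-capped J W L with ≤-<-connex W L
  ... | inj₁ W≤L = ≤-trans (m+n≤o⇒m≤o _ (sum-capped-≥ J W L W≤L)) (≤-reflexive (cong (3 *_) (sym (large-≥ W≤L))))
  ... | inj₂ L<W = ≤-trans (≤-reflexive (sum-capped-< J W L L<W)) z≤n

  -- The factor `b ^ (J ∸ suc j)` rescales the demand `level W (suc j)` of level `j` to `level W J`,
  -- see `level-top`.
  sumSmall : ℕ → ℕ → ℕ → ℕ
  sumSmall J W L = sumTo J (λ j → b ^ (J ∸ suc j) * small (level W j) L)

  -- A geometric series of ratio `1/b ≤ 1/2` is at most twice its first term, `b ^ (J ∸ 1) * L`. The
  -- factor `b` on the left avoids the predecessor in the exponent.
  sum-small-L : ∀ J W L → b * sumSmall J W L ≤ 2 * (b ^ J * L)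
  sum-small-L zero    W L = ≤-trans (≤-reflexive (*-zeroʳ b)) z≤n
  sum-small-L (suc J) W L = begin
    b * (b ^ J * small W L + sumSmall J (b * W) L)          ≡⟨ *-distribˡ-+ b (b ^ J * small W L) _ ⟩
    b * (b ^ J * small W L) + b * sumSmall J (b * W) L      ≤⟨ +-mono-≤ (*-monoʳ-≤ b (*-monoʳ-≤ (b ^ J) (small≤ W L))) (sum-small-L J (b * W) L) ⟩
    b * (b ^ J * L) + 2 * (b ^ J * L)                       ≤⟨ +-monoʳ-≤ _ (2*≤ (b ^ J * L)) ⟩
    b * (b ^ J * L) + b * (b ^ J * L)                       ≡⟨ shuffle b (b ^ J) L ⟩
    2 * (b * b ^ J * L)                                     ∎
    where
    open ≤-Reasoning
    shuffle : ∀ b p L → b * (p * L) + b * (p * L) ≡ 2 * (b * p * L)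
    shuffle = solve-∀

  -- Levels of length at most `L` contribute nothing. From the first longer level on, the geometric
  -- bound applies with `L` below that level, whose multiple by the remaining power of `b` is the
  -- top level.
  sum-small-level : ∀ J W L → b * sumSmall J W L ≤ 2 * level W J
  sum-small-level J W L with ≤-<-connex W L
  sum-small-level J W L | inj₂ L<W = ≤-trans (sum-small-L J W L)
    (*-monoʳ-≤ 2 (≤-trans (*-monoʳ-≤ (b ^ J) (<⇒≤ L<W)) (≤-reflexive (sym (level-^ W J)))))
  sum-small-level zero W L | inj₁ W≤L = ≤-trans (≤-reflexive (*-zeroʳ b)) z≤n
  sum-small-level (suc J) W L | inj₁ W≤L = begin
    b * (b ^ J * small W L + sumSmall J (b * W) L)          ≡⟨ cong (λ x → b * (b ^ J * x + sumSmall J (b * W) L)) (small-≥ W≤L) ⟩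
    b * (b ^ J * 0 + sumSmall J (b * W) L)                  ≡⟨ cong (λ x → b * (x + sumSmall J (b * W) L)) (*-zeroʳ (b ^ J)) ⟩
    b * sumSmall J (b * W) L                                ≤⟨ sum-small-level J (b * W) L ⟩
    2 * level (b * W) J                                     ∎
    where open ≤-Reasoning

  sum-small : ∀ J W L → b * sumSmall J W L ≤ 2 * level W J * (1 ⊓ L)
  sum-small J W zero    = ≤-trans (sum-small-L J W 0)
    (≤-reflexive (trans (cong (2 *_) (*-zeroʳ (b ^ J))) (sym (*-zeroʳ (2 * level W J)))))
  sum-small J W (suc L) = ≤-trans (sum-small-level J W (suc L)) (≤-reflexive (sym (*-identityʳ _)))

  -- Averaging over time windows

  module _ {S n W c : ℕ} (2S≤W : S + S ≤ W) (tr : Trace S n W c) where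
    open Trace tr

    -- Of the `T′` items gained from time `u` to time `t`, free words account for at most `S`, hence
    -- for at most half. The other half is left to short blocks at `t` and to the growth of the
    -- capped weight of `hist`; its value at `u` stands on the left to avoid subtraction.
    window : ∀ T T′ u {t} → T′ + u ≡ t → t ≤ n → S + S ≤ T′ →
             T′ + 2 * total (capped T T′) (hist u) ≤
             2 * total (small T) (sizes t) + 2 * total (capped T T′) (hist t)
    window T T′ u {t} refl t≤n 2S≤T′ with evolve (m≤n+m u T′) t≤n
    ... | born , hist-t , below = begin
      T′ + 2 * H u                                   ≤⟨ +-monoˡ-≤ _ T′≤ ⟩
      2 * Fs + 2 * Fc + 2 * H u                      ≡⟨ shuffle₃ Fs Fc (H u) ⟩
      2 * Fs + 2 * (Fc + H u)                        ≡⟨ cong (λ x → 2 * Fs + 2 * x) (total-++ (capped T T′) born (hist u)) ⟨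
      2 * Fs + 2 * total (capped T T′) (born ++ hist u)  ≡⟨ cong (λ x → 2 * Fs + 2 * total (capped T T′) x) hist-t ⟨
      2 * Fs + 2 * H t                               ∎
      where
      open ≤-Reasoning
      H : ℕ → ℕ
      H x = total (capped T T′) (hist x)
      Fs = total (small T) (sizes t)
      Fl = total (large T) born
      Fc = total (capped T T′) born
      -- Long blocks at time `t` are newborn or were present at time `u`, when all blocks together
      -- had at most `u + S` words.
      uncapped : T′ ≤ Fs + Fl + S
      uncapped = +-cancelʳ-≤ u _ _ (begin
        T′ + u                                       ≤⟨ lower t≤n ⟩
        total id (sizes t)                           ≡⟨ total-cong (sizes t) ⟨
        total (λ L → small T L + large T L) (sizes t)  ≡⟨ total-+ (small T) (large T) (sizes t) ⟩
        Fs + total (large T) (sizes t)               ≤⟨ +-monoʳ-≤ Fs (below (large T)) ⟩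
        Fs + (Fl + total (large T) (sizes u))        ≤⟨ +-monoʳ-≤ Fs (+-monoʳ-≤ Fl (≤-trans (total-mono (large≤ T) (sizes u)) (upper (≤-trans (m≤n+m u T′) t≤n)))) ⟩
        Fs + (Fl + (u + S))                          ≡⟨ shuffle₁ Fs Fl u S ⟩
        Fs + Fl + S + u                              ∎)
        where
        total-cong : ∀ xs → total (λ L → small T L + large T L) xs ≡ total id xs
        total-cong []       = refl
        total-cong (x ∷ xs) = cong₂ _+_ (small+large T x) (total-cong xs)
        shuffle₁ : ∀ a b c d → a + (b + (c + d)) ≡ a + b + d + c
        shuffle₁ = solve-∀
      -- One window never needs more than `T′` from the newborn blocks together; `total-⊓` then
      -- distributes this minimum over the single blocks.
      cap : T′ ≤ Fs + (Fl ⊓ T′) + S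
      cap with ≤-total Fl T′
      ... | inj₁ Fl≤T′ = subst (λ x → T′ ≤ Fs + x + S) (sym (m≤n⇒m⊓n≡m Fl≤T′)) uncapped
      ... | inj₂ T′≤Fl = subst (λ x → T′ ≤ Fs + x + S) (sym (m≥n⇒m⊓n≡n T′≤Fl))
                           (≤-trans (m≤n+m T′ Fs) (m≤m+n _ S))
      T′≤ : T′ ≤ 2 * Fs + 2 * Fc
      T′≤ = +-cancelʳ-≤ T′ _ _ (begin
        T′ + T′                                      ≤⟨ +-mono-≤ cap cap ⟩
        Fs + (Fl ⊓ T′) + S + (Fs + (Fl ⊓ T′) + S)    ≡⟨ shuffle₂ Fs (Fl ⊓ T′) S ⟩
        2 * Fs + 2 * (Fl ⊓ T′) + (S + S)             ≤⟨ +-mono-≤ (+-monoʳ-≤ (2 * Fs) (*-monoʳ-≤ 2 (total-⊓ (large T) T′ born))) 2S≤T′ ⟩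
        2 * Fs + 2 * Fc + T′                         ∎)
        where
        shuffle₂ : ∀ a b c → a + b + c + (a + b + c) ≡ 2 * a + 2 * b + (c + c)
        shuffle₂ = solve-∀
      shuffle₃ : ∀ a b c → 2 * a + 2 * b + 2 * c ≡ 2 * a + 2 * (b + c)
      shuffle₃ = solve-∀

    hist-mono : ∀ f {t} → t ≤ n → total f (hist t) ≤ total f (hist n)
    hist-mono f {t} t≤n with evolve t≤n ≤-refl
    ... | born , eq , _ = ≤-trans (m≤n+m _ (total f born))
      (≤-reflexive (sym (trans (cong (total f) eq) (total-++ f born (hist t)))))

    -- Over `M` consecutive starting times the accumulated weights `H` cancel, up to `T′` excess
    -- terms that are at most the final weight: a birth lies in at most `T′` windows.
    windows : ∀ T T′ o M → o + (T′ + M) ≤ n → S + S ≤ T′ →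
              M * T′ ≤ 2 * sumTo M (λ i → total (small T) (sizes (o + (T′ + i)))) +
                       2 * (T′ * total (capped T T′) (hist n))
    windows T T′ o M end≤n 2S≤T′ = +-cancelʳ-≤ (2 * sumTo M H) _ _ (begin
      M * T′ + 2 * sumTo M H
        ≡⟨ cong₂ _+_ (sumTo-const M T′) (sumTo-* M 2 H) ⟨
      sumTo M (λ _ → T′) + sumTo M (λ i → 2 * H i)
        ≡⟨ sumTo-+ M (λ _ → T′) (λ i → 2 * H i) ⟨
      sumTo M (λ i → T′ + 2 * H i)
        ≤⟨ sumTo-mono M (λ i i<M → window T T′ (o + i) (shuffle₁ T′ o i)
             (≤-trans (+-monoʳ-≤ o (+-monoʳ-≤ T′ (<⇒≤ i<M))) end≤n) 2S≤T′) ⟩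
      sumTo M (λ i → 2 * F i + 2 * H (T′ + i))
        ≡⟨ sumTo-+ M (λ i → 2 * F i) (λ i → 2 * H (T′ + i)) ⟩
      sumTo M (λ i → 2 * F i) + sumTo M (λ i → 2 * H (T′ + i))
        ≡⟨ cong₂ _+_ (sumTo-* M 2 F) (sumTo-* M 2 (λ i → H (T′ + i))) ⟩
      2 * sumTo M F + 2 * sumTo M (λ i → H (T′ + i))
        ≤⟨ +-monoʳ-≤ (2 * sumTo M F) (*-monoʳ-≤ 2 (sumTo-shift M T′ H
             (λ t t≤ → hist-mono (capped T T′) (≤-trans (+-monoʳ-≤ o t≤) end≤n)))) ⟩
      2 * sumTo M F + 2 * (sumTo M H + T′ * total (capped T T′) (hist n))
        ≡⟨ shuffle₂ (sumTo M F) (sumTo M H) _ ⟩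
      2 * sumTo M F + 2 * (T′ * total (capped T T′) (hist n)) + 2 * sumTo M H ∎)
      where
      open ≤-Reasoning
      H F : ℕ → ℕ
      H i = total (capped T T′) (hist (o + i))
      F i = total (small T) (sizes (o + (T′ + i)))
      shuffle₁ : ∀ a b c → a + (b + c) ≡ b + (a + c)
      shuffle₁ = solve-∀
      shuffle₂ : ∀ a b c → 2 * a + 2 * (b + c) ≡ 2 * a + 2 * c + 2 * b
      shuffle₂ = solve-∀

    module _ {J M : ℕ} (end≤n : level W J + M ≤ n) where

      top = level W J

      small-at : ℕ → ℕ → ℕ
      small-at j i = total (λ L → b ^ (J ∸ suc j) * small (level W j) L) (sizes (top + i))

      capped-at : ℕ → ℕ
      capped-at j = total (capped (level W j) (level W (suc j))) (hist n)

      level-windows : ∀ j → j < J → M * top ≤ 2 * sumTo M (small-at j) + 2 * top * capped-at j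
      level-windows j j<J = begin
        M * top                                              ≡⟨ cong (M *_) (level-top W j<J) ⟨
        M * (w * T′)                                         ≡⟨ shuffle₁ M w T′ ⟩
        w * (M * T′)                                         ≤⟨ *-monoʳ-≤ w (windows (level W j) T′ o M o+≤n (≤-trans 2S≤W (level≥ W (suc j)))) ⟩
        w * (2 * sumTo M F + 2 * (T′ * capped-at j))         ≡⟨ shuffle₂ w (sumTo M F) T′ (capped-at j) ⟩
        2 * (w * sumTo M F) + 2 * (w * T′) * capped-at j     ≡⟨ cong₂ (λ x y → 2 * x + 2 * y * capped-at j) (sym (sumTo-* M w F)) (level-top W j<J) ⟩
        2 * sumTo M (λ i → w * F i) + 2 * top * capped-at j  ≤⟨ +-monoˡ-≤ _ (*-monoʳ-≤ 2 (sumTo-mono M (λ i _ → ≤-reflexive (wF i)))) ⟩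
        2 * sumTo M (small-at j) + 2 * top * capped-at j     ∎
        where
        open ≤-Reasoning
        w = b ^ (J ∸ suc j)
        T′ = level W (suc j)
        -- With this offset the windows of every level end at the times `top + i`, so one bound on
        -- the number of blocks at such a time serves all levels.
        o = top ∸ T′
        T′≤top : T′ ≤ top
        T′≤top = ≤-trans (m≤n*m T′ w {{m^n≢0 b (J ∸ suc j) {{>-nonZero (≤-trans (s≤s z≤n) 2≤b)}}}})
                         (≤-reflexive (level-top W j<J))
        o+ : ∀ i → o + (T′ + i) ≡ top + i
        o+ i = trans (sym (+-assoc o T′ i)) (cong (_+ i) (m∸n+n≡m T′≤top))
        o+≤n : o + (T′ + M) ≤ n
        o+≤n = ≤-trans (≤-reflexive (o+ M)) end≤n
        F : ℕ → ℕ
        F i = total (small (level W j)) (sizes (o + (T′ + i)))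
        wF : ∀ i → w * F i ≡ small-at j i
        wF i = trans (sym (total-* w (small (level W j)) (sizes (o + (T′ + i)))))
                     (cong (λ t → total (λ L → w * small (level W j) L) (sizes t)) (o+ i))
        shuffle₁ : ∀ a b c → a * (b * c) ≡ b * (a * c)
        shuffle₁ = solve-∀
        shuffle₂ : ∀ w f t a → w * (2 * f + 2 * (t * a)) ≡ 2 * (w * f) + 2 * (w * t) * a
        shuffle₂ = solve-∀

      all-small : b * sumTo J (λ j → sumTo M (small-at j)) ≤ M * (2 * top * suc (S + S))
      all-small = begin
        b * sumTo J (λ j → sumTo M (small-at j))             ≡⟨ cong (b *_) (sumTo-swap J M small-at) ⟩
        b * sumTo M (λ i → sumTo J (λ j → small-at j i))     ≡⟨ sumTo-* M b _ ⟨
        sumTo M (λ i → b * sumTo J (λ j → small-at j i))     ≤⟨ sumTo-mono M (λ i i<M → at i (≤-trans (+-monoʳ-≤ top (<⇒≤ i<M)) end≤n)) ⟩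
        sumTo M (λ _ → 2 * top * suc (S + S))                ≡⟨ sumTo-const M _ ⟩
        M * (2 * top * suc (S + S))                          ∎
        where
        open ≤-Reasoning
        at : ∀ i → top + i ≤ n → b * sumTo J (λ j → small-at j i) ≤ 2 * top * suc (S + S)
        at i t≤n = begin
          b * sumTo J (λ j → small-at j i)                   ≡⟨ cong (b *_) (sumTo-total J (λ j L → b ^ (J ∸ suc j) * small (level W j) L) Ls) ⟩
          b * total (sumSmall J W) Ls                        ≡⟨ total-* b (sumSmall J W) Ls ⟨
          total (λ L → b * sumSmall J W L) Ls                ≤⟨ total-mono (sum-small J W) Ls ⟩
          total (λ L → 2 * top * (1 ⊓ L)) Ls                 ≡⟨ total-* (2 * top) (1 ⊓_) Ls ⟩
          2 * top * total (1 ⊓_) Ls                          ≤⟨ *-monoʳ-≤ (2 * top) (few t≤n) ⟩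
          2 * top * suc (S + S)                              ∎
          where Ls = sizes (top + i)

      -- The 6 is the factor 3 of the geometric series times the factor 2 lost to free words.
      all-capped : sumTo J capped-at ≤ 6 * c
      all-capped = begin
        sumTo J capped-at                                    ≡⟨ sumTo-total J (λ j → capped (level W j) (level W (suc j))) (hist n) ⟩
        total (λ L → sumTo J (λ j → capped (level W j) (level W (suc j)) L)) (hist n)
                                                             ≤⟨ total-mono (sum-capped J W) (hist n) ⟩
        total (λ L → 3 * large W L) (hist n)                 ≡⟨ total-* 3 (large W) (hist n) ⟩
        3 * total (large W) (hist n)                         ≤⟨ *-monoʳ-≤ 3 paid ⟩
        3 * (2 * c)                                          ≡⟨ *-assoc 3 2 c ⟨
        6 * c                                                ∎
        where open ≤-Reasoning

      summed : b * (J * M) * top ≤ (4 * (M * suc (S + S)) + 12 * (b * c)) * top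
      summed = begin
        b * (J * M) * top                                    ≡⟨ shuffle₁ b J M top ⟩
        b * (J * (M * top))                                  ≡⟨ cong (b *_) (sumTo-const J (M * top)) ⟨
        b * sumTo J (λ _ → M * top)                          ≤⟨ *-monoʳ-≤ b (sumTo-mono J level-windows) ⟩
        b * sumTo J (λ j → 2 * sumTo M (small-at j) + 2 * top * capped-at j)
          ≡⟨ cong (b *_) (trans (sumTo-+ J (λ j → 2 * sumTo M (small-at j)) (λ j → 2 * top * capped-at j))
               (cong₂ _+_ (sumTo-* J 2 (λ j → sumTo M (small-at j))) (sumTo-* J (2 * top) capped-at))) ⟩
        b * (2 * sumTo J (λ j → sumTo M (small-at j)) + 2 * top * sumTo J capped-at)
          ≡⟨ shuffle₂ b (sumTo J (λ j → sumTo M (small-at j))) top _ ⟩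
        2 * (b * sumTo J (λ j → sumTo M (small-at j))) + 2 * top * b * sumTo J capped-at
          ≤⟨ +-mono-≤ (*-monoʳ-≤ 2 all-small) (*-monoʳ-≤ (2 * top * b) all-capped) ⟩
        2 * (M * (2 * top * suc (S + S))) + 2 * top * b * (6 * c)
          ≡⟨ shuffle₃ M top (suc (S + S)) b c ⟩
        (4 * (M * suc (S + S)) + 12 * (b * c)) * top         ∎
        where
        open ≤-Reasoning
        shuffle₁ : ∀ b J M t → b * (J * M) * t ≡ b * (J * (M * t))
        shuffle₁ = solve-∀
        shuffle₂ : ∀ b x t y → b * (2 * x + 2 * t * y) ≡ 2 * (b * x) + 2 * t * b * y
        shuffle₂ = solve-∀
        shuffle₃ : ∀ M t k b c → 2 * (M * (2 * t * k)) + 2 * t * b * (6 * c) ≡ (4 * (M * k) + 12 * (b * c)) * t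
        shuffle₃ = solve-∀

      -- The hypothesis `8 * suc (S + S) ≤ b * J` confines the short blocks to half of the total
      -- demand of all levels, so the newborn blocks must meet the other half.
      level-bound : 1 ≤ W → 8 * suc (S + S) ≤ b * J → J * M ≤ 24 * c
      level-bound 1≤W few-blocks = *-cancelˡ-≤ b {{>-nonZero (≤-trans (s≤s z≤n) 2≤b)}}
        (+-cancelˡ-≤ (b * (J * M)) _ _ (begin
          b * (J * M) + b * (J * M)                          ≤⟨ +-mono-≤ bJM≤ bJM≤ ⟩
          4 * (M * K) + 12 * (b * c) + (4 * (M * K) + 12 * (b * c))  ≡⟨ shuffle₁ M K b c ⟩
          8 * K * M + b * (24 * c)                           ≤⟨ +-monoˡ-≤ _ (*-monoˡ-≤ M few-blocks) ⟩
          b * J * M + b * (24 * c)                           ≡⟨ cong (_+ b * (24 * c)) (*-assoc b J M) ⟩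
          b * (J * M) + b * (24 * c)                         ∎))
        where
        open ≤-Reasoning
        K = suc (S + S)
        bJM≤ : b * (J * M) ≤ 4 * (M * K) + 12 * (b * c)
        bJM≤ = *-cancelʳ-≤ _ _ top {{>-nonZero (≤-trans 1≤W (level≥ W J))}} summed
        shuffle₁ : ∀ M k b c → 4 * (M * k) + 12 * (b * c) + (4 * (M * k) + 12 * (b * c)) ≡ 8 * k * M + b * (24 * c)
        shuffle₁ = solve-∀

-- Powers and binary logarithms

n<2^n : ∀ n → n < 2 ^ n
n<2^n zero    = s≤s z≤n
n<2^n (suc n) = begin
  suc (suc n)        ≤⟨ s≤s (n<2^n n) ⟩
  suc (2 ^ n)        ≤⟨ +-monoˡ-≤ (2 ^ n) (m^n>0 2 n) ⟩
  2 ^ n + 2 ^ n      ≡⟨ cong (2 ^ n +_) (+-identityʳ (2 ^ n)) ⟨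
  2 ^ suc n          ∎
  where open ≤-Reasoning

n²≤2*2^n : ∀ n → n * n ≤ 2 * 2 ^ n
n²≤2*2^n zero    = z≤n
n²≤2*2^n (suc n) = begin
  suc n * suc n              ≤⟨ n≤1+n _ ⟩
  suc (suc n * suc n)        ≡⟨ expand n ⟩
  n * n + 2 * suc n          ≤⟨ +-mono-≤ (n²≤2*2^n n) (*-monoʳ-≤ 2 (n<2^n n)) ⟩
  2 * 2 ^ n + 2 * 2 ^ n      ≡⟨ double (2 ^ n) ⟩
  2 * 2 ^ suc n              ∎
  where
  open ≤-Reasoning
  expand : ∀ n → suc (suc n * suc n) ≡ n * n + 2 * suc n
  expand = solve-∀
  double : ∀ x → 2 * x + 2 * x ≡ 2 * (2 * x)
  double = solve-∀

-- From `1 ≤ h` follows `2 * h + 1 ≤ 3 * h`, and from `6 * a ≤ h` that twice the left side is at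
-- most `h * h`.
linear≤2^ : ∀ a {h} → 6 * a + 1 ≤ h → a * (2 * h + 1) ≤ 2 ^ h
linear≤2^ a {h} a≤h = *-cancelˡ-≤ 2 (begin
  2 * (a * (2 * h + 1))      ≤⟨ *-monoʳ-≤ 2 (*-monoʳ-≤ a (+-monoʳ-≤ (2 * h) (m+n≤o⇒n≤o (6 * a) a≤h))) ⟩
  2 * (a * (2 * h + h))      ≡⟨ collect a h ⟩
  6 * a * h                  ≤⟨ *-monoˡ-≤ h (m+n≤o⇒m≤o (6 * a) a≤h) ⟩
  h * h                      ≤⟨ n²≤2*2^n h ⟩
  2 * 2 ^ h                  ∎)
  where
  open ≤-Reasoning
  collect : ∀ a h → 2 * (a * (2 * h + h)) ≡ 6 * a * h
  collect = solve-∀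

2^⌊log₂n⌋≤n : ∀ n → 1 ≤ n → 2 ^ ⌊log₂ n ⌋ ≤ n
2^⌊log₂n⌋≤n n 1≤n = go ⌊log₂ n ⌋ n refl 1≤n
  where
  open ≤-Reasoning
  go : ∀ k n → ⌊log₂ n ⌋ ≡ k → 1 ≤ n → 2 ^ k ≤ n
  go zero    n                 _  1≤n = 1≤n
  go (suc k) n@(suc (suc n-2)) eq _   = begin
    2 * 2 ^ k                ≤⟨ *-monoʳ-≤ 2 (go k ⌊ n /2⌋ (trans (⌊log₂⌊n/2⌋⌋≡⌊log₂n⌋∸1 n) (cong (_∸ 1) eq)) (s≤s z≤n)) ⟩
    2 * ⌊ n /2⌋              ≡⟨ cong (⌊ n /2⌋ +_) (+-identityʳ ⌊ n /2⌋) ⟩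
    ⌊ n /2⌋ + ⌊ n /2⌋        ≤⟨ +-monoʳ-≤ ⌊ n /2⌋ (⌊n/2⌋≤⌈n/2⌉ n) ⟩
    ⌊ n /2⌋ + ⌈ n /2⌉        ≡⟨ ⌊n/2⌋+⌈n/2⌉≡n n ⟩
    n                        ∎

n<2^[1+⌊log₂n⌋] : ∀ n → n < 2 ^ suc ⌊log₂ n ⌋
n<2^[1+⌊log₂n⌋] n with ≤-<-connex (2 ^ suc ⌊log₂ n ⌋) n
... | inj₂ n<    = n<
... | inj₁ 2^≤n  = contradiction
  (≤-trans (≤-reflexive (sym (⌊log₂[2^n]⌋≡n (suc ⌊log₂ n ⌋)))) (⌊log₂⌋-mono-≤ 2^≤n)) 1+n≰n

^-cancelˡ-≤ : ∀ r {x y} → 1 ≤ r → x ^ r ≤ y ^ r → x ≤ y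
^-cancelˡ-≤ r 1≤r x^r≤y^r = ≮⇒≥ (λ y<x → <⇒≱ (^-monoˡ-< r {{>-nonZero 1≤r}} y<x) x^r≤y^r)

^-distribʳ-* : ∀ r x y → (x * y) ^ r ≡ x ^ r * y ^ r
^-distribʳ-* zero    x y = refl
^-distribʳ-* (suc r) x y = trans (cong (x * y *_) (^-distribʳ-* r x y)) (shuffle x y (x ^ r) (y ^ r))
  where
  shuffle : ∀ x y p q → x * y * (p * q) ≡ x * p * (y * q)
  shuffle = solve-∀

m<[1+m/n]*n : ∀ m n .{{_ : NonZero n}} → m < suc (m / n) * n
m<[1+m/n]*n m n = begin-strict
  m                      ≡⟨ m≡m%n+[m/n]*n m n ⟩
  m % n + m / n * n      <⟨ +-monoˡ-< (m / n * n) (m%n<n m n) ⟩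
  n + m / n * n          ∎
  where open ≤-Reasoning

-- Choice of the levels for given `N` and `r`

module Parameters
  (c₁ c₂ q a E : ℕ) (c₁<a : 2 * c₁ < a) (c₂<E : c₂ * suc q < E) (q-large : 64 * a * E ≤ 2 ^ q)
  (s : ℕ → ℕ) (s-mono : NonDecreasing s)
  (N r : ℕ) (1≤r : 1 ≤ r)
  (s-bound : ∀ n → s n ^ r ≤ (c₁ * r) ^ r * suc n)
  {m : Memory} {c : ℕ} (ex : GrowExec s N m c)
  where

  D : ℕ
  D = 4 * E

  -- For `r` below the constant `D` there need not be any level, but a linear cost suffices: all
  -- items beyond the `s 0` initial words must be paid for, and `s 0` is at most half of `N`.
  cost-small-r : 2 * (c₁ * D) ≤ N → r ≤ D → r * N ≤ 96 * D * c
  cost-small-r N-large r≤D = begin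
    r * N                  ≤⟨ *-mono-≤ r≤D N≤2c ⟩
    D * (2 * c)            ≤⟨ *-monoʳ-≤ D (*-monoˡ-≤ c {2} {96} (s≤s (s≤s z≤n))) ⟩
    D * (96 * c)           ≡⟨ shuffle D c ⟩
    96 * D * c             ∎
    where
    open ≤-Reasoning
    s0≤ : s 0 ≤ c₁ * D
    s0≤ = ≤-trans (^-cancelˡ-≤ r 1≤r (≤-trans (s-bound 0) (≤-reflexive (*-identityʳ _)))) (*-monoʳ-≤ c₁ r≤D)
    N≤2c : N ≤ 2 * c
    N≤2c = +-cancelˡ-≤ N _ _ (begin
      N + N                  ≡⟨ cong (N +_) (+-identityʳ N) ⟨
      2 * N                  ≤⟨ *-monoʳ-≤ 2 (items-paid ex) ⟩
      2 * (s 0 + c)          ≡⟨ *-distribˡ-+ 2 (s 0) c ⟩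
      2 * s 0 + 2 * c        ≤⟨ +-monoˡ-≤ (2 * c) (≤-trans (*-monoʳ-≤ 2 s0≤) N-large) ⟩
      N + 2 * c              ∎)
    shuffle : ∀ D c → D * (96 * c) ≡ 96 * D * c
    shuffle = solve-∀

  module LargeR (L : ℕ) (2^L≤N : 2 ^ L ≤ N) (N<2^[1+L] : N < 2 ^ suc L) (r≤ : r ≤ c₂ * L)
                   (L-large : 4 * a * c₂ * L ≤ 2 ^ (L / 2)) (D≤r : D ≤ r) where
    open ≤-Reasoning

    instance
      r≢0 : NonZero r
      r≢0 = >-nonZero 1≤r
      E≢0 : NonZero E
      E≢0 = >-nonZero (≤-trans (s≤s z≤n) c₂<E)
      D≢0 : NonZero D
      D≢0 = m*n≢0 4 E

    -- `2 ^ p` stands for `N ^ (1/r)`: `L < p * r` gives `suc N ≤ 2 ^ (p * r)`, while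
    -- `r * p ≤ L + r` keeps it within a factor of 2. The further factor `2 ^ q` of `b` is there to
    -- outweigh the number of blocks in `8K≤bJ`.
    J p b S K W : ℕ
    J = r / D
    p = suc (L / r)
    b = 2 ^ (p + q)
    S = c₁ * r * 2 ^ p
    K = suc (S + S)
    W = K + K

    1≤J : 1 ≤ J
    1≤J = m≥n⇒m/n>0 D≤r

    r≤2DJ : r ≤ 2 * D * J
    r≤2DJ = begin
      r                    ≤⟨ <⇒≤ (m<[1+m/n]*n r D) ⟩
      suc J * D            ≤⟨ *-monoˡ-≤ D (+-monoˡ-≤ J 1≤J) ⟩
      (J + J) * D          ≡⟨ shuffle J D ⟩
      2 * D * J            ∎
      where
      shuffle : ∀ J D → (J + J) * D ≡ 2 * D * J
      shuffle = solve-∀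

    rp≤ : r * p ≤ L + r
    rp≤ = begin
      r * p                ≡⟨ *-comm r p ⟩
      r + L / r * r        ≤⟨ +-monoʳ-≤ r (m/n*n≤m L r) ⟩
      r + L                ≡⟨ +-comm r L ⟩
      L + r                ∎

    s≤S : ∀ {t} → t ≤ N → s t ≤ S
    s≤S t≤N = ≤-trans (s-mono t≤N) (^-cancelˡ-≤ r 1≤r (begin
      s N ^ r                        ≤⟨ s-bound N ⟩
      (c₁ * r) ^ r * suc N           ≤⟨ *-monoʳ-≤ ((c₁ * r) ^ r) N<2^[1+L] ⟩
      (c₁ * r) ^ r * 2 ^ suc L       ≤⟨ *-monoʳ-≤ ((c₁ * r) ^ r) (^-monoʳ-≤ 2 (m<[1+m/n]*n L r)) ⟩
      (c₁ * r) ^ r * 2 ^ (p * r)     ≡⟨ cong ((c₁ * r) ^ r *_) (^-*-assoc 2 p r) ⟨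
      (c₁ * r) ^ r * (2 ^ p) ^ r     ≡⟨ ^-distribʳ-* r (c₁ * r) (2 ^ p) ⟨
      S ^ r                          ∎))

    K≤ : K ≤ a * r * 2 ^ p
    K≤ = begin
      1 + (S + S)                    ≤⟨ +-monoˡ-≤ (S + S) (*-mono-≤ 1≤r (m^n>0 2 p)) ⟩
      r * 2 ^ p + (S + S)            ≡⟨ shuffle c₁ r (2 ^ p) ⟩
      suc (2 * c₁) * r * 2 ^ p       ≤⟨ *-monoˡ-≤ (2 ^ p) (*-monoˡ-≤ r c₁<a) ⟩
      a * r * 2 ^ p                  ∎
      where
      shuffle : ∀ c r x → r * x + (c * r * x + c * r * x) ≡ suc (2 * c) * r * x
      shuffle = solve-∀

    8K≤bJ : 8 * K ≤ b * J
    8K≤bJ = begin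
      8 * K                          ≤⟨ *-monoʳ-≤ 8 K≤ ⟩
      8 * (a * r * 2 ^ p)            ≤⟨ *-monoʳ-≤ 8 (*-monoˡ-≤ (2 ^ p) (*-monoʳ-≤ a r≤2DJ)) ⟩
      8 * (a * (2 * D * J) * 2 ^ p)  ≡⟨ shuffle₁ a E J (2 ^ p) ⟩
      64 * a * E * (2 ^ p * J)       ≤⟨ *-monoˡ-≤ (2 ^ p * J) q-large ⟩
      2 ^ q * (2 ^ p * J)            ≡⟨ shuffle₂ (2 ^ q) (2 ^ p) J ⟩
      2 ^ p * 2 ^ q * J              ≡⟨ cong (_* J) (^-distribˡ-+-* 2 p q) ⟨
      b * J                          ∎
      where
      shuffle₁ : ∀ a E J x → 8 * (a * (2 * (4 * E) * J) * x) ≡ 64 * a * E * (x * J)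
      shuffle₁ = solve-∀
      shuffle₂ : ∀ y x J → y * (x * J) ≡ x * y * J
      shuffle₂ = solve-∀

    2≤b : 2 ≤ b
    2≤b = ^-monoʳ-≤ 2 {1} (≤-trans (s≤s z≤n) (m≤m+n p q))

    open Levels b 2≤b

    -- `(p + q) * r` is at most `L + r * suc q`, hence at most `L * E`; dividing `r` by `D = 4 * E`
    -- therefore brings `(p + q) * J` below `L / 4`. A second quarter covers the extra `p`, and the
    -- other half of the exponent absorbs the linear factors in `2*top≤N`.
    exponent : p + (p + q) * J ≤ L / 2
    exponent = begin
      p + x                  ≡⟨ m*n/n≡m (p + x) 2 ⟨
      (p + x) * 2 / 2        ≤⟨ /-monoˡ-≤ 2 (≤-trans (*-monoˡ-≤ 2 (+-monoˡ-≤ x p≤x)) (≤-trans (≤-reflexive (shuffle₂ x)) 4x≤L)) ⟩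
      L / 2                  ∎
      where
      x = (p + q) * J
      p≤x : p ≤ x
      p≤x = ≤-trans (m≤m+n p q) (≤-trans (≤-reflexive (sym (*-identityʳ (p + q)))) (*-monoʳ-≤ (p + q) 1≤J))
      shuffle₁ : ∀ p q J E → 4 * ((p + q) * J) * E ≡ (p + q) * (J * (4 * E))
      shuffle₁ = solve-∀
      shuffle₂ : ∀ x → (x + x) * 2 ≡ 4 * x
      shuffle₂ = solve-∀
      shuffle₃ : ∀ p q r → (p + q) * r ≡ r * p + r * q
      shuffle₃ = solve-∀
      shuffle₄ : ∀ L r q → L + r + r * q ≡ L + r * suc q
      shuffle₄ = solve-∀
      shuffle₅ : ∀ L c q → L + c * L * suc q ≡ L * suc (c * suc q)
      shuffle₅ = solve-∀
      4x≤L : 4 * x ≤ L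
      4x≤L = *-cancelʳ-≤ _ _ E (begin
        4 * x * E                    ≡⟨ shuffle₁ p q J E ⟩
        (p + q) * (J * D)            ≤⟨ *-monoʳ-≤ (p + q) (m/n*n≤m r D) ⟩
        (p + q) * r                  ≡⟨ shuffle₃ p q r ⟩
        r * p + r * q                ≤⟨ +-monoˡ-≤ (r * q) rp≤ ⟩
        L + r + r * q                ≡⟨ shuffle₄ L r q ⟩
        L + r * suc q                ≤⟨ +-monoʳ-≤ L (*-monoˡ-≤ (suc q) r≤) ⟩
        L + c₂ * L * suc q           ≡⟨ shuffle₅ L c₂ q ⟩
        L * suc (c₂ * suc q)         ≤⟨ *-monoʳ-≤ L c₂<E ⟩
        L * E                        ∎)

    2*top≤N : 2 * level W J ≤ N
    2*top≤N = begin
      2 * level W J                        ≡⟨ cong (2 *_) (level-^ W J) ⟩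
      2 * (b ^ J * (K + K))                ≡⟨ shuffle₁ (b ^ J) K ⟩
      4 * K * b ^ J                        ≤⟨ *-mono-≤ (*-monoʳ-≤ 4 K≤) (≤-reflexive (^-*-assoc 2 (p + q) J)) ⟩
      4 * (a * r * 2 ^ p) * 2 ^ ((p + q) * J)  ≡⟨ shuffle₂ a r (2 ^ p) _ ⟩
      4 * a * r * (2 ^ p * 2 ^ ((p + q) * J))  ≡⟨ cong (4 * a * r *_) (^-distribˡ-+-* 2 p ((p + q) * J)) ⟨
      4 * a * r * 2 ^ (p + (p + q) * J)    ≤⟨ *-mono-≤ (*-monoʳ-≤ (4 * a) r≤) (^-monoʳ-≤ 2 exponent) ⟩
      4 * a * (c₂ * L) * 2 ^ (L / 2)       ≤⟨ *-monoˡ-≤ (2 ^ (L / 2)) (≤-trans (≤-reflexive (sym (*-assoc (4 * a) c₂ L))) L-large) ⟩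
      2 ^ (L / 2) * 2 ^ (L / 2)            ≡⟨ ^-distribˡ-+-* 2 (L / 2) (L / 2) ⟨
      2 ^ (L / 2 + L / 2)                  ≤⟨ ^-monoʳ-≤ 2 (≤-trans (≤-reflexive (shuffle₃ (L / 2))) (m/n*n≤m L 2)) ⟩
      2 ^ L                                ≤⟨ 2^L≤N ⟩
      N                                    ∎
      where
      shuffle₁ : ∀ x K → 2 * (x * (K + K)) ≡ 4 * K * x
      shuffle₁ = solve-∀
      shuffle₂ : ∀ a r x y → 4 * (a * r * x) * y ≡ 4 * a * r * (x * y)
      shuffle₂ = solve-∀
      shuffle₃ : ∀ x → x + x ≡ x * 2
      shuffle₃ = solve-∀

    M : ℕ
    M = N ∸ level W J

    top+M≡N : level W J + M ≡ N
    top+M≡N = m+[n∸m]≡n (≤-trans (m≤m+n (level W J) _) 2*top≤N)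

    N≤2M : N ≤ 2 * M
    N≤2M = +-cancelʳ-≤ (2 * level W J) _ _ (begin
      N + 2 * level W J                    ≤⟨ +-monoʳ-≤ N 2*top≤N ⟩
      N + N                                ≡⟨ cong₂ _+_ top+M≡N top+M≡N ⟨
      level W J + M + (level W J + M)      ≡⟨ shuffle (level W J) M ⟩
      2 * M + 2 * level W J                ∎)
      where
      shuffle : ∀ x M → x + M + (x + M) ≡ 2 * M + 2 * x
      shuffle = solve-∀

    2S≤W : S + S ≤ W
    2S≤W = ≤-trans (n≤1+n (S + S)) (m≤m+n K K)

    JM≤24c : J * M ≤ 24 * c
    JM≤24c = level-bound 2S≤W (proj₁ (trace ex s≤S 2S≤W)) (≤-reflexive top+M≡N) (s≤s z≤n) 8K≤bJ

    cost-large-r : r * N ≤ 96 * D * c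
    cost-large-r = begin
      -- The 96 is 2 from rounding `r / D`, 2 from `N ≤ 2 * M`, and 24 from `JM≤24c`.
      r * N                          ≤⟨ *-mono-≤ r≤2DJ N≤2M ⟩
      2 * D * J * (2 * M)            ≡⟨ shuffle₁ D J M ⟩
      4 * D * (J * M)                ≤⟨ *-monoʳ-≤ (4 * D) JM≤24c ⟩
      4 * D * (24 * c)               ≡⟨ shuffle₂ D c ⟩
      96 * D * c                     ∎
      where
      shuffle₁ : ∀ D J M → 2 * D * J * (2 * M) ≡ 4 * D * (J * M)
      shuffle₁ = solve-∀
      shuffle₂ : ∀ D c → 4 * D * (24 * c) ≡ 96 * D * c
      shuffle₂ = solve-∀

-- Constants and conclusion

-- The two requirements are circular: `E` must exceed a multiple of `q`, and `2 ^ q` a multiple of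
-- `E`. With `E` linear in `q`, a large `q` satisfies both.
fanout-constant : ∀ a c → ∃₂ λ q E → c * suc q < E × 64 * a * E ≤ 2 ^ q
fanout-constant a c = q , suc (c * suc q) , ≤-refl , (begin
  64 * a * suc (c * suc q)                   ≤⟨ *-monoʳ-≤ (64 * a) (+-mono-≤ (s≤s {n = 2 * q} z≤n) (*-monoʳ-≤ c (s≤s (m≤m+n q _)))) ⟩
  64 * a * (suc (2 * q) + c * suc (2 * q))   ≡⟨ shuffle (64 * a) c q ⟩
  64 * a * suc c * (2 * q + 1)               ≤⟨ linear≤2^ (64 * a * suc c) ≤-refl ⟩
  2 ^ q                                      ∎)
  where
  open ≤-Reasoning
  q = 6 * (64 * a * suc c) + 1
  shuffle : ∀ x c q → x * (suc (2 * q) + c * suc (2 * q)) ≡ x * suc c * (2 * q + 1)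
  shuffle = solve-∀

linear≤2^half : ∀ a → ∃ λ L₀ → ∀ {L} → L₀ ≤ L → a * L ≤ 2 ^ (L / 2)
linear≤2^half a = (6 * a + 1) * 2 , λ {L} L₀≤L → begin
  a * L                      ≤⟨ *-monoʳ-≤ a (L≤ L) ⟩
  a * (2 * (L / 2) + 1)      ≤⟨ linear≤2^ a (≤-trans (≤-reflexive (sym (m*n/n≡m (6 * a + 1) 2))) (/-monoˡ-≤ 2 L₀≤L)) ⟩
  2 ^ (L / 2)                ∎
  where
  open ≤-Reasoning
  shuffle : ∀ h → suc h * 2 ≡ suc (2 * h + 1)
  shuffle = solve-∀
  L≤ : ∀ L → L ≤ 2 * (L / 2) + 1
  L≤ L = ≤-pred (≤-trans (m<[1+m/n]*n L 2) (≤-reflexive (shuffle (L / 2))))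

-- The bound on `s` is `s n ≤ c₁ * r * (n + 1) ^ (1/r)` without roots, and `r * N ≤ d * c` is an
-- amortized cost of at least `r / d` per grow operation.
GrowBound : (c₁ c₂ d N₀ : ℕ) → Set
GrowBound c₁ c₂ d N₀ =
  (N r : ℕ) → N₀ ≤ N → 1 ≤ r → r ≤ c₂ * ⌊log₂ N ⌋ →
  (s : ℕ → ℕ) → NonDecreasing s →
  (∀ n → s n ^ r ≤ (c₁ * r) ^ r * suc n) →
  (m : Memory) (c : ℕ) → GrowExec s N m c →
  r * N ≤ d * c

grow-cost : ∀ c₁ c₂ q a E {L₀} → 2 * c₁ < a → c₂ * suc q < E → 64 * a * E ≤ 2 ^ q →
            (∀ {L} → L₀ ≤ L → 4 * a * c₂ * L ≤ 2 ^ (L / 2)) →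
            GrowBound c₁ c₂ (96 * (4 * E)) (2 ^ L₀ + 2 * (c₁ * (4 * E)))
grow-cost c₁ c₂ q a E {L₀} c₁<a c₂<E q-large beyond-L₀ N r N₀≤N 1≤r r≤ s s-mono s-bound m c ex
  with ≤-total r (4 * E)
... | inj₁ r≤D = Parameters.cost-small-r c₁ c₂ q a E c₁<a c₂<E q-large s s-mono N r 1≤r s-bound ex
  (m+n≤o⇒n≤o (2 ^ L₀) N₀≤N) r≤D
... | inj₂ D≤r = Parameters.LargeR.cost-large-r c₁ c₂ q a E c₁<a c₂<E q-large s s-mono N r 1≤r s-bound ex
  ⌊log₂ N ⌋ (2^⌊log₂n⌋≤n N (≤-trans (m^n>0 2 L₀) 2^L₀≤N)) (n<2^[1+⌊log₂n⌋] N) r≤ (beyond-L₀ L₀≤log) D≤r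
  where
  2^L₀≤N : 2 ^ L₀ ≤ N
  2^L₀≤N = m+n≤o⇒m≤o (2 ^ L₀) N₀≤N
  L₀≤log : L₀ ≤ ⌊log₂ N ⌋
  L₀≤log = ≤-trans (≤-reflexive (sym (⌊log₂[2^n]⌋≡n L₀))) (⌊log₂⌋-mono-≤ 2^L₀≤N)

theorem9p1 : (c₁ c₂ : ℕ) → Σ ℕ λ d → Σ ℕ λ N₀ →
    (N r : ℕ) → N₀ ≤ N → 1 ≤ r → r ≤ c₂ * ⌊log₂ N ⌋ →
    (s : ℕ → ℕ) → NonDecreasing s →
    (∀ n → s n ^ r ≤ (c₁ * r) ^ r * suc n) →
    (m : Memory) (c : ℕ) → GrowExec s N m c →
    r * N ≤ d * c
theorem9p1 c₁ c₂ = from-constants (suc (2 * c₁)) ≤-refl (fanout-constant (suc (2 * c₁)) c₂)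
  (linear≤2^half (4 * suc (2 * c₁) * c₂))
  where
  from-constants : ∀ a → 2 * c₁ < a → (∃₂ λ q E → c₂ * suc q < E × 64 * a * E ≤ 2 ^ q) →
                   (∃ λ L₀ → ∀ {L} → L₀ ≤ L → 4 * a * c₂ * L ≤ 2 ^ (L / 2)) →
                   Σ ℕ λ d → Σ ℕ λ N₀ → GrowBound c₁ c₂ d N₀
  from-constants a c₁<a (q , E , c₂<E , q-large) (L₀ , beyond-L₀) =
    96 * (4 * E) , 2 ^ L₀ + 2 * (c₁ * (4 * E)) ,
    grow-cost c₁ c₂ q a E c₁<a c₂<E q-large beyond-L₀
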